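{- There exist $\delta>0$ and $D$ such that for every $d>D$ the $d$-dimensional hypercube has Brunn-Minkowski curvature at least $\frac{1}{2d}(1+\delta)$; that is, for all nonempty sets $S,T$ of vertices of the $d$-dimensional hypercube, $$|\widehat{m}(S,T)|\ge\sqrt{|S||T|}\;e^{\frac{1+\delta}{16d}d_*(S,T)^2}.$$
   Context: The $d$-dimensional hypercube has vertex set $\{0,1\}^d$ with the Hamming distance $d(\cdot,\cdot)$. For points $a,b$, $$\widehat{m}(a,b)=\{u: d(a,u)=\lfloor d(a,b)/2\rfloor,\ d(a,u)+d(u,b)=d(a,b)\}\cup\{u: d(a,u)=\lceil d(a,b)/2\rceil,\ d(a,u)+d(u,b)=d(a,b)\},$$ $\widehat{m}(S,T)=\bigcup_{s\in S,t\in T}\widehat{m}(s,t)$, and $d_*(S,T)=\min\{d(s,t):s\in S,t\in T\}$. The Brunn-Minkowski curvature is the supremum of the values $K$ such that $|\widehat{m}(S,T)|\ge\sqrt{|S||T|}\,e^{\frac K8d_*(S,T)^2}$ for all nonempty sets $S,T$. -}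

module Defs where

open import Algebra.Definitions.RawSemiring using (_^_)
open import Data.Bool using (Bool; true; false; _≟_)
open import Data.Integer using (+_)
open import Data.List using (List; []; _∷_; _++_; map; length; filterᵇ; cartesianProductWith)
open import Data.List.Extrema.Nat using (min)
open import Data.List.Relation.Unary.Any using (any?)
open import Data.Nat using (ℕ; zero; suc; _+_; _*_; _≤_; _!; ⌊_/2⌋; ⌈_/2⌉)
import Data.Nat as ℕ
open import Data.Nat.Properties using (_!≢0)
open import Data.Product using (∃-syntax; _×_; _,_)
open import Data.Rational as ℚ using (ℚ; 0ℚ; +-*-rawSemiring)
open import Data.Sum using (_⊎_)
open import Data.Vec using (Vec; []; _∷_; count; zip)
open import Level using (0ℓ)
open import Relation.Binary.PropositionalEquality using (_≡_)
open import Relation.Nullary using (Dec; ¬?; ⌊_⌋; _×-dec_; _⊎-dec_)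
open import Relation.Unary using (Pred; _⊆_)

------------------------------------------------------------------------
-- Real numbers
--
-- The standard library has no real numbers. An (extended) real x is
-- represented by its lower Dedekind cut, the set of rationals q < x.
-- The empty and full cuts stand for -∞ and +∞. The order of the reals
-- is inclusion of cuts.

ℝ : Set₁
ℝ = Pred ℚ 0ℓ

infix 4 _≤ᴿ_ _≥ᴿ_

_≤ᴿ_ _≥ᴿ_ : ℝ → ℝ → Set
x ≤ᴿ y = x ⊆ y
x ≥ᴿ y = y ≤ᴿ x

fromℚ : ℚ → ℝ
fromℚ q p = p ℚ.< q

infix 10 _/1

_/1 : ℕ → ℚ
n /1 = + n ℚ./ 1

fromℕ : ℕ → ℝ
fromℕ n = fromℚ (n /1)

√_ : ℕ → ℝ
(√ n) p = p ℚ.< 0ℚ ⊎ p ℚ.* p ℚ.< n /1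

-- The product of two nonnegative reals. It is not the product when a
-- factor is negative.
infixl 7 _·_

_·_ : ℝ → ℝ → ℝ
(x · y) p = p ℚ.< 0ℚ ⊎
  (∃[ a ] ∃[ b ] 0ℚ ℚ.≤ a × 0ℚ ℚ.≤ b × x a × y b × p ℚ.≤ a ℚ.* b)

-- The cut of lim inf aₙ, which is the limit whenever a converges.
lim : (ℕ → ℚ) → ℝ
lim a q = ∃[ r ] q ℚ.< r × (∃[ N ] (∀ n → N ≤ n → r ℚ.≤ a n))

expTerm : ℚ → ℕ → ℚ
expTerm x n = _^_ +-*-rawSemiring x n ℚ.* ((+ 1) ℚ./ (n !)) {{n !≢0}}

expSum : ℚ → ℕ → ℚ
expSum x zero    = 0ℚ
expSum x (suc n) = expSum x n ℚ.+ expTerm x n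

exp : ℚ → ℝ
exp x = lim (expSum x)

------------------------------------------------------------------------
-- The hypercube

Vertex : ℕ → Set
Vertex d = Vec Bool d

hamming : ∀ {d} → Vertex d → Vertex d → ℕ
hamming a b = count (λ (x , y) → ¬? (x ≟ y)) (zip a b)

vertices : ∀ d → List (Vertex d)
vertices zero    = [] ∷ []
vertices (suc d) = map (false ∷_) (vertices d) ++ map (true ∷_) (vertices d)

VertexSet : ℕ → Set
VertexSet d = Vertex d → Bool

Nonempty : ∀ {d} → VertexSet d → Set
Nonempty S = ∃[ s ] S s ≡ true

elements : ∀ {d} → VertexSet d → List (Vertex d)
elements {d} S = filterᵇ S (vertices d)

∣_∣ : ∀ {d} → VertexSet d → ℕ
∣ S ∣ = length (elements S)

Midpoint : ∀ {d} → Vertex d → Vertex d → Vertex d → Set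
Midpoint a b u =
  (hamming a u ≡ ⌊ hamming a b /2⌋ × hamming a u + hamming u b ≡ hamming a b) ⊎
  (hamming a u ≡ ⌈ hamming a b /2⌉ × hamming a u + hamming u b ≡ hamming a b)

midpoint? : ∀ {d} (a b u : Vertex d) → Dec (Midpoint a b u)
midpoint? a b u =
  (hamming a u ℕ.≟ ⌊ hamming a b /2⌋ ×-dec hamming a u + hamming u b ℕ.≟ hamming a b) ⊎-dec
  (hamming a u ℕ.≟ ⌈ hamming a b /2⌉ ×-dec hamming a u + hamming u b ℕ.≟ hamming a b)

m̂ : ∀ {d} → VertexSet d → VertexSet d → VertexSet d
m̂ S T u = ⌊ any? (λ s → any? (λ t → midpoint? s t u) (elements T)) (elements S) ⌋

-- `min` takes a starting value. Since all distances are at most d,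
-- starting from d does not change the minimum when S and T are nonempty.
d⋆ : ∀ {d} → VertexSet d → VertexSet d → ℕ
d⋆ {d} S T = min d (cartesianProductWith hamming (elements S) (elements T))

------------------------------------------------------------------------
-- Brunn-Minkowski curvature

BrunnMinkowski : ℕ → ℚ → Set
BrunnMinkowski d K = (S T : VertexSet d) → Nonempty S → Nonempty T →
  fromℕ ∣ m̂ S T ∣ ≥ᴿ
    √ (∣ S ∣ * ∣ T ∣) · exp (K ℚ.* (+ 1 ℚ./ 8) ℚ.* (d⋆ S T * d⋆ S T) /1)

-- The cut of the supremum of all K satisfying the inequality. That
-- condition is inherited by smaller K, so rational K give the same
-- supremum as real K.
curvature : ℕ → ℝ
curvature d q = ∃[ K ] q ℚ.< K × BrunnMinkowski d K

module Submission where

-- Group the pairs (a , b) of vertices by pairing up consecutive coordinates in which a and b differ; a class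
-- consists of the 2ⁿ pairs obtained by exchanging a and b on some of these coordinate pairs. Exchanging a and
-- b in exactly one coordinate of each pair maps a class onto another one whose members are pairs of
-- midpoints. So |m̂(S,T)|² is at least the total size of the classes that meet S × T, and it suffices that
-- S × T is sparse in each class. The members of S × T in a class form a set Q ⊆ {0,1}ⁿ with n ≤ (d + 1)/2,
-- and twice the distance of Q from its antipodal set is at least p = d⋆(S,T). Sets at distance e in {0,1}ⁿ
-- satisfy |A| |B| ≤ (2 + ν + 1/ν)ⁿ ν^e for 0 < ν ≤ 1, by induction on n. Optimising ν would give
-- |Q| ≤ 2ⁿ exp(- p²/(4d)) up to lower order, where exp(- (1 + δ) p²/(8d)) is needed. The slack permits a
-- rational ν, and permits replacing exp(p w), where w = (1 + δ) p/(16d), by its upper bound (1 - w)^(- p).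

open import Defs
open import Algebra.Bundles using (CommutativeRing)
open import Data.Bool using (Bool; true; false; not; _∧_; _xor_; if_then_else_)
open import Data.Bool.Properties using (not-involutive; T-≡)
open import Data.Integer as ℤ using (+_)
import Data.Integer.Properties as ℤ
open import Data.List using (length; filterᵇ; cartesianProductWith)
import Data.List as List
open import Data.List.Extrema.Nat using (min≤⊤; min≤xs)
open import Data.List.Membership.Propositional using (_∈_; lose)
open import Data.List.Membership.Propositional.Properties using (∈-++⁺ˡ; ∈-++⁺ʳ; ∈-map⁺; ∈-filter⁺; ∈-cartesianProductWith⁺)
open import Data.List.Properties using (filter-++; length-++)
import Data.List.Relation.Unary.All as All
open import Data.List.Relation.Unary.Any using (here)
open import Data.Nat as ℕ using (ℕ; zero; suc; NonZero; _!; z≤n; s≤s; ⌊_/2⌋; ⌈_/2⌉)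
import Data.Nat.Properties as ℕ
open import Data.Nat.Tactic.RingSolver using (solve-∀)
open import Data.Product using (∃-syntax; _×_; _,_)
open import Data.Rational as ℚ using (ℚ; 0ℚ; 1ℚ; ½)
import Data.Rational.Properties as ℚ
open import Data.Rational.Solver using (module +-*-Solver)
import Data.Rational.Unnormalised as ℚᵘ
import Data.Rational.Unnormalised.Properties as ℚᵘ
open import Data.Sum using (_⊎_; inj₁; inj₂; [_,_]′)
open import Data.Vec using ([]; _∷_; map)
open import Data.Vec.Properties using (map-∘; map-cong; map-id)
open import Function using (_∘_)
open import Function.Bundles using (Equivalence)
open import Relation.Binary.PropositionalEquality
open import Relation.Nullary using (yes; no; contradiction)
open import Relation.Nullary.Decidable using (T?; toWitness; fromWitness)
open CommutativeRing ℚ.+-*-commutativeRing using (semiring; commutativeSemiring)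
open import Algebra.Properties.Semiring.Exp semiring using (^-homo-*; ^-assocʳ) renaming (_^_ to _^ℚ_)
open import Algebra.Properties.CommutativeSemiring.Exp commutativeSemiring using (^-distrib-*)
open +-*-Solver using (solve; _:+_; _:*_; _:-_; :-_; con; _:=_)

-- Rational bounds

module _ where
  open import Data.Rational using (_+_; _*_; _-_; -_; _/_; _≤_; _<_; _≤?_; toℚᵘ; positive; nonNegative; nonPositive)
  open import Data.Rational.Properties

  ≤-byDifference : ∀ {x y} r → 0ℚ ≤ r → x + r ≡ y → x ≤ y
  ≤-byDifference {x} {y} r 0≤r eq = begin
    x       ≡⟨ +-identityʳ x ⟨
    x + 0ℚ  ≤⟨ +-monoʳ-≤ x 0≤r ⟩
    x + r   ≡⟨ eq ⟩
    y       ∎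
    where open ≤-Reasoning

  0≤y-x : ∀ {x y} → x ≤ y → 0ℚ ≤ y - x
  0≤y-x {x} {y} x≤y = begin
    0ℚ     ≡⟨ +-inverseʳ x ⟨
    x - x  ≤⟨ +-monoˡ-≤ (- x) x≤y ⟩
    y - x  ∎
    where open ≤-Reasoning

  0≤+ : ∀ {x y} → 0ℚ ≤ x → 0ℚ ≤ y → 0ℚ ≤ x + y
  0≤+ = +-mono-≤ {0ℚ} {_} {0ℚ}

  *-monoˡ : ∀ {x y} z → 0ℚ ≤ z → x ≤ y → z * x ≤ z * y
  *-monoˡ z 0≤z = *-monoˡ-≤-nonNeg z {{nonNegative 0≤z}}

  *-monoʳ : ∀ {x y} z → 0ℚ ≤ z → x ≤ y → x * z ≤ y * z
  *-monoʳ z 0≤z = *-monoʳ-≤-nonNeg z {{nonNegative 0≤z}}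

  0≤* : ∀ {x y} → 0ℚ ≤ x → 0ℚ ≤ y → 0ℚ ≤ x * y
  0≤* {x} {y} 0≤x 0≤y = begin
    0ℚ      ≡⟨ *-zeroʳ x ⟨
    x * 0ℚ  ≤⟨ *-monoˡ x 0≤x 0≤y ⟩
    x * y   ∎
    where open ≤-Reasoning

  *-mono : ∀ {x y u v} → 0ℚ ≤ x → 0ℚ ≤ u → x ≤ y → u ≤ v → x * u ≤ y * v
  *-mono {x} {y} {u} {v} 0≤x 0≤u x≤y u≤v = ≤-trans (*-monoʳ u 0≤u x≤y) (*-monoˡ y (≤-trans 0≤x x≤y) u≤v)

  *-pos : ∀ {x y} → 0ℚ < x → 0ℚ < y → 0ℚ < x * y
  *-pos {x} {y} 0<x 0<y = positive⁻¹ (x * y) {{pos*pos⇒pos x {{positive 0<x}} y {{positive 0<y}}}}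

  0≤² : ∀ x → 0ℚ ≤ x * x
  0≤² x with ≤-total 0ℚ x
  ... | inj₁ 0≤x = 0≤* 0≤x 0≤x
  ... | inj₂ x≤0 = nonNegative⁻¹ (x * x) {{nonPos*nonPos⇒nonPos x {{nonPositive x≤0}} x {{nonPositive x≤0}}}}

  0≤1 : 0ℚ ≤ 1ℚ
  0≤1 = nonNegative⁻¹ 1ℚ

  0≤^ : ∀ {x} n → 0ℚ ≤ x → 0ℚ ≤ x ^ℚ n
  0≤^ zero    0≤x = 0≤1
  0≤^ (suc n) 0≤x = 0≤* 0≤x (0≤^ n 0≤x)

  ^-pos : ∀ {x} n → 0ℚ < x → 0ℚ < x ^ℚ n
  ^-pos zero    0<x = positive⁻¹ 1ℚ
  ^-pos (suc n) 0<x = *-pos 0<x (^-pos n 0<x)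

  ^-monoˡ : ∀ {x y} n → 0ℚ ≤ x → x ≤ y → x ^ℚ n ≤ y ^ℚ n
  ^-monoˡ zero    0≤x x≤y = ≤-refl
  ^-monoˡ (suc n) 0≤x x≤y = *-mono 0≤x (0≤^ n 0≤x) x≤y (^-monoˡ n 0≤x x≤y)

  1^n≡1 : ∀ n → 1ℚ ^ℚ n ≡ 1ℚ
  1^n≡1 zero    = refl
  1^n≡1 (suc n) = trans (*-identityˡ _) (1^n≡1 n)

  ^-antitone : ∀ {x m n} → 0ℚ ≤ x → x ≤ 1ℚ → m ℕ.≤ n → x ^ℚ n ≤ x ^ℚ m
  ^-antitone {n = n} 0≤x x≤1 ℕ.z≤n       = ≤-trans (^-monoˡ n 0≤x x≤1) (≤-reflexive (1^n≡1 n))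
  ^-antitone {x}     0≤x x≤1 (ℕ.s≤s m≤n) = *-monoˡ x 0≤x (^-antitone 0≤x x≤1 m≤n)

  toℚᵘ-/ : ∀ m d .{{_ : ℕ.NonZero d}} → toℚᵘ (+ m / d) ℚᵘ.≃ (+ m ℚᵘ./ d)
  toℚᵘ-/ m (suc d) = toℚᵘ-fromℚᵘ (ℚᵘ.mkℚᵘ (+ m) d)

  /1-homo-+ : ∀ m n → (m ℕ.+ n) /1 ≡ m /1 + n /1
  /1-homo-+ m n = toℚᵘ-injective (begin
    toℚᵘ ((m ℕ.+ n) /1)              ≈⟨ toℚᵘ-/ (m ℕ.+ n) 1 ⟩
    + (m ℕ.+ n) ℚᵘ./ 1               ≈⟨ ℚᵘ.*≡* (cong (ℤ._* + 1) (sym (cong₂ ℤ._+_ (ℤ.*-identityʳ (+ m)) (ℤ.*-identityʳ (+ n))))) ⟩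
    (+ m ℚᵘ./ 1) ℚᵘ.+ (+ n ℚᵘ./ 1)   ≈⟨ ℚᵘ.+-cong (toℚᵘ-/ m 1) (toℚᵘ-/ n 1) ⟨
    toℚᵘ (m /1) ℚᵘ.+ toℚᵘ (n /1)     ≈⟨ toℚᵘ-homo-+ (m /1) (n /1) ⟨
    toℚᵘ (m /1 + n /1)               ∎)
    where open ℚᵘ.≃-Reasoning

  /1-homo-* : ∀ m n → (m ℕ.* n) /1 ≡ m /1 * n /1
  /1-homo-* m n = toℚᵘ-injective (begin
    toℚᵘ ((m ℕ.* n) /1)              ≈⟨ toℚᵘ-/ (m ℕ.* n) 1 ⟩
    + (m ℕ.* n) ℚᵘ./ 1               ≈⟨ ℚᵘ.*≡* (cong (ℤ._* + 1) (ℤ.pos-* m n)) ⟩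
    (+ m ℚᵘ./ 1) ℚᵘ.* (+ n ℚᵘ./ 1)   ≈⟨ ℚᵘ.*-cong (toℚᵘ-/ m 1) (toℚᵘ-/ n 1) ⟨
    toℚᵘ (m /1) ℚᵘ.* toℚᵘ (n /1)     ≈⟨ toℚᵘ-homo-* (m /1) (n /1) ⟨
    toℚᵘ (m /1 * n /1)               ∎)
    where open ℚᵘ.≃-Reasoning

  /1-mono : ∀ {m n} → m ℕ.≤ n → m /1 ≤ n /1
  /1-mono {m} {n} m≤n = toℚᵘ-cancel-≤ (begin
    toℚᵘ (m /1)    ≃⟨ toℚᵘ-/ m 1 ⟩
    + m ℚᵘ./ 1     ≤⟨ ℚᵘ.*≤* (ℤ.*-monoʳ-≤-nonNeg (+ 1) (ℤ.+≤+ m≤n)) ⟩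
    + n ℚᵘ./ 1     ≃⟨ toℚᵘ-/ n 1 ⟨
    toℚᵘ (n /1)    ∎)
    where open ℚᵘ.≤-Reasoning

  0≤/1 : ∀ n → 0ℚ ≤ n /1
  0≤/1 n = /1-mono {0} {n} ℕ.z≤n

  suc-/1 : ∀ n → suc n /1 ≡ 1ℚ + n /1
  suc-/1 = /1-homo-+ 1

  1/d*d≡1 : ∀ d .{{_ : ℕ.NonZero d}} → (+ 1 / d) * d /1 ≡ 1ℚ
  1/d*d≡1 d@(suc k) = toℚᵘ-injective (begin
    toℚᵘ ((+ 1 / d) * d /1)            ≈⟨ toℚᵘ-homo-* (+ 1 / d) (d /1) ⟩
    toℚᵘ (+ 1 / d) ℚᵘ.* toℚᵘ (d /1)    ≈⟨ ℚᵘ.*-cong (toℚᵘ-/ 1 d) (toℚᵘ-/ d 1) ⟩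
    (+ 1 ℚᵘ./ d) ℚᵘ.* (+ d ℚᵘ./ 1)     ≈⟨ ℚᵘ.*≡* (cong +_ (ℕ.*-assoc 1 d 1)) ⟩
    ℚᵘ.1ℚᵘ                             ∎)
    where open ℚᵘ.≃-Reasoning

  0≤1/d : ∀ d .{{_ : ℕ.NonZero d}} → 0ℚ ≤ + 1 / d
  0≤1/d d = nonNegative⁻¹ (+ 1 / d) {{normalize-nonNeg 1 d}}

  bernoulli : ∀ x n → 0ℚ ≤ 1ℚ + x → 1ℚ + n /1 * x ≤ (1ℚ + x) ^ℚ n
  bernoulli x zero    0≤1+x = ≤-reflexive (solve 1 (λ x → con 1ℚ :+ con 0ℚ :* x := con 1ℚ) refl x)
  bernoulli x (suc n) 0≤1+x = begin
    1ℚ + suc n /1 * x                ≡⟨ cong (λ k → 1ℚ + k * x) (suc-/1 n) ⟩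
    1ℚ + (1ℚ + n /1) * x             ≤⟨ ≤-byDifference (n /1 * (x * x)) (0≤* (0≤/1 n) (0≤² x)) (identity x (n /1)) ⟩
    (1ℚ + x) * (1ℚ + n /1 * x)       ≤⟨ *-monoˡ (1ℚ + x) 0≤1+x (bernoulli x n 0≤1+x) ⟩
    (1ℚ + x) ^ℚ suc n                 ∎
    where
    open ≤-Reasoning
    identity : ∀ x k → (1ℚ + (1ℚ + k) * x) + k * (x * x) ≡ (1ℚ + x) * (1ℚ + k * x)
    identity = solve 2 (λ x k → (con 1ℚ :+ (con 1ℚ :+ k) :* x) :+ k :* (x :* x) :=
                                (con 1ℚ :+ x) :* (con 1ℚ :+ k :* x)) refl

  -- By Bernoulli both factors are at most powers with exponent n * p.
  weighted-amgm : ∀ z n p → 0ℚ ≤ z → z ≤ 1ℚ → n /1 * z ≤ 1ℚ →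
    (1ℚ + p /1 * z) ^ℚ n * (1ℚ - n /1 * z) ^ℚ p ≤ 1ℚ
  weighted-amgm z n p 0≤z z≤1 nz≤1 = begin
    (1ℚ + p /1 * z) ^ℚ n * (1ℚ - n /1 * z) ^ℚ p
      ≤⟨ *-mono (0≤^ n 0≤1+pz) (0≤^ p 0≤1-nz) (^-monoˡ n 0≤1+pz (bernoulli z p 0≤1+z)) (^-monoˡ p 0≤1-nz 1-nz≤) ⟩
    ((1ℚ + z) ^ℚ p) ^ℚ n * ((1ℚ - z) ^ℚ n) ^ℚ p
      ≡⟨ cong₂ _*_ (^-assocʳ (1ℚ + z) p n) (trans (^-assocʳ (1ℚ - z) n p) (cong ((1ℚ - z) ^ℚ_) (ℕ.*-comm n p))) ⟩
    (1ℚ + z) ^ℚ (p ℕ.* n) * (1ℚ - z) ^ℚ (p ℕ.* n)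
      ≡⟨ ^-distrib-* (1ℚ + z) (1ℚ - z) (p ℕ.* n) ⟨
    ((1ℚ + z) * (1ℚ - z)) ^ℚ (p ℕ.* n)
      ≤⟨ ^-monoˡ (p ℕ.* n) (0≤* 0≤1+z (0≤y-x z≤1)) (≤-byDifference (z * z) (0≤* 0≤z 0≤z) difference-of-squares) ⟩
    1ℚ ^ℚ (p ℕ.* n)
      ≡⟨ 1^n≡1 (p ℕ.* n) ⟩
    1ℚ ∎
    where
    open ≤-Reasoning
    0≤1+z : 0ℚ ≤ 1ℚ + z
    0≤1+z = 0≤+ 0≤1 0≤z
    0≤1+pz : 0ℚ ≤ 1ℚ + p /1 * z
    0≤1+pz = 0≤+ 0≤1 (0≤* (0≤/1 p) 0≤z)
    0≤1-nz : 0ℚ ≤ 1ℚ - n /1 * z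
    0≤1-nz = 0≤y-x nz≤1
    1-nz≤ : 1ℚ - n /1 * z ≤ (1ℚ - z) ^ℚ n
    1-nz≤ = subst (_≤ (1ℚ - z) ^ℚ n) (cong (λ y → 1ℚ + y) (sym (neg-distribʳ-* (n /1) z))) (bernoulli (- z) n (0≤y-x z≤1))
    difference-of-squares : (1ℚ + z) * (1ℚ - z) + z * z ≡ 1ℚ
    difference-of-squares = solve 1 (λ z → (con 1ℚ :+ z) :* (con 1ℚ :- z) :+ z :* z := con 1ℚ) refl z

  -- Partial sums of the exponential

  -- This is AM-GM for n copies of x + y and one of x - n y, whose mean is x; the induction also
  -- covers negative x - n y.
  amgm-step : ∀ x y n → 0ℚ ≤ x → 0ℚ ≤ y → (x + y) ^ℚ n * (x - n /1 * y) ≤ x ^ℚ suc n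
  amgm-step x y zero    0≤x 0≤y = ≤-reflexive (solve 2 (λ x y → con 1ℚ :* (x :- con 0ℚ :* y) := x :* con 1ℚ) refl x y)
  amgm-step x y (suc n) 0≤x 0≤y = begin
    (x + y) ^ℚ suc n * (x - suc n /1 * y)
      ≡⟨ cong (λ k → (x + y) ^ℚ suc n * (x - k * y)) (suc-/1 n) ⟩
    (x + y) ^ℚ suc n * (x - (1ℚ + n /1) * y)
      ≤⟨ ≤-byDifference _ (0≤* (0≤^ n (0≤+ 0≤x 0≤y)) (0≤* (0≤+ 0≤1 (0≤/1 n)) (0≤* 0≤y 0≤y))) (identity x y (n /1) ((x + y) ^ℚ n)) ⟩
    x * ((x + y) ^ℚ n * (x - n /1 * y))
      ≤⟨ *-monoˡ x 0≤x (amgm-step x y n 0≤x 0≤y) ⟩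
    x ^ℚ suc (suc n) ∎
    where
    open ≤-Reasoning
    identity : ∀ x y k w → (x + y) * w * (x - (1ℚ + k) * y) + w * ((1ℚ + k) * (y * y)) ≡ x * (w * (x - k * y))
    identity = solve 4 (λ x y k w → (x :+ y) :* w :* (x :- (con 1ℚ :+ k) :* y) :+ w :* ((con 1ℚ :+ k) :* (y :* y)) :=
                                    x :* (w :* (x :- k :* y))) refl

  1/!_ : ℕ → ℚ
  1/! n = (+ 1 / (n !)) {{n ℕ.!≢0}}

  1/!-suc : ∀ n → (1/! n) ≡ suc n /1 * (1/! (suc n))
  1/!-suc n = begin
    (1/! n)                                             ≡⟨ *-identityʳ ((1/! n)) ⟨
    (1/! n) * 1ℚ                                        ≡⟨ cong ((1/! n) *_) (1/d*d≡1 (suc n !) {{suc n ℕ.!≢0}}) ⟨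
    (1/! n) * ((1/! (suc n)) * (suc n !) /1)               ≡⟨ cong (λ k → (1/! n) * ((1/! (suc n)) * k)) (/1-homo-* (suc n) (n !)) ⟩
    (1/! n) * ((1/! (suc n)) * (suc n /1 * (n !) /1))      ≡⟨ rearrange ((1/! n)) ((1/! (suc n))) (suc n /1) ((n !) /1) ⟩
    (1/! n) * (n !) /1 * (suc n /1 * (1/! (suc n)))        ≡⟨ cong (_* (suc n /1 * (1/! (suc n)))) (1/d*d≡1 (n !) {{n ℕ.!≢0}}) ⟩
    1ℚ * (suc n /1 * (1/! (suc n)))                       ≡⟨ *-identityˡ _ ⟩
    suc n /1 * (1/! (suc n))                              ∎
    where
    open ≡-Reasoning
    rearrange : ∀ a b c d → a * (b * (c * d)) ≡ a * d * (c * b)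
    rearrange = solve 4 (λ a b c d → a :* (b :* (c :* d)) := a :* d :* (c :* b)) refl

  0≤1/! : ∀ n → 0ℚ ≤ (1/! n)
  0≤1/! n = 0≤1/d (n !) {{n ℕ.!≢0}}

  0≤expTerm : ∀ {x} n → 0ℚ ≤ x → 0ℚ ≤ expTerm x n
  0≤expTerm n 0≤x = 0≤* (0≤^ n 0≤x) (0≤1/! n)

  -- Multiplied by (n + 1)!, the left side is (x + y)^n ((x + y) - (n + 1) y), so this is
  -- `amgm-step`.
  expTerm-suc : ∀ x y n → 0ℚ ≤ x → 0ℚ ≤ y →
    expTerm (x + y) (suc n) - y * expTerm (x + y) n ≤ expTerm x (suc n)
  expTerm-suc x y n 0≤x 0≤y = begin
    (x + y) ^ℚ suc n * f′ - y * ((x + y) ^ℚ n * (1/! n))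
      ≡⟨ cong (λ k → (x + y) ^ℚ suc n * f′ - y * ((x + y) ^ℚ n * k)) (trans (1/!-suc n) (cong (_* f′) (suc-/1 n))) ⟩
    (x + y) ^ℚ suc n * f′ - y * ((x + y) ^ℚ n * ((1ℚ + n /1) * f′))
      ≡⟨ identity x y (n /1) ((x + y) ^ℚ n) f′ ⟩
    (x + y) ^ℚ n * (x - n /1 * y) * f′
      ≤⟨ *-monoʳ f′ (0≤1/! (suc n)) (amgm-step x y n 0≤x 0≤y) ⟩
    x ^ℚ suc n * f′ ∎
    where
    open ≤-Reasoning
    f′ : ℚ
    f′ = (1/! (suc n))
    identity : ∀ x y k w f → (x + y) * w * f - y * (w * ((1ℚ + k) * f)) ≡ w * (x - k * y) * f
    identity = solve 5 (λ x y k w f → (x :+ y) :* w :* f :- y :* (w :* ((con 1ℚ :+ k) :* f)) :=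
                                      w :* (x :- k :* y) :* f) refl

  expSum-suc : ∀ x y n → 0ℚ ≤ x → 0ℚ ≤ y →
    expSum (x + y) (suc n) - y * expSum (x + y) n ≤ expSum x (suc n)
  expSum-suc x y zero    0≤x 0≤y = ≤-reflexive (trans (cong (λ k → 1ℚ - k) (*-zeroʳ y)) refl)
  expSum-suc x y (suc n) 0≤x 0≤y = begin
    expSum (x + y) (suc n) + expTerm (x + y) (suc n) - y * (expSum (x + y) n + expTerm (x + y) n)
      ≡⟨ rearrange (expSum (x + y) (suc n)) (expTerm (x + y) (suc n)) y (expSum (x + y) n) (expTerm (x + y) n) ⟩
    (expSum (x + y) (suc n) - y * expSum (x + y) n) + (expTerm (x + y) (suc n) - y * expTerm (x + y) n)
      ≤⟨ +-mono-≤ (expSum-suc x y n 0≤x 0≤y) (expTerm-suc x y n 0≤x 0≤y) ⟩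
    expSum x (suc (suc n)) ∎
    where
    open ≤-Reasoning
    rearrange : ∀ s t y s′ t′ → s + t - y * (s′ + t′) ≡ (s - y * s′) + (t - y * t′)
    rearrange = solve 5 (λ s t y s′ t′ → s :+ t :- y :* (s′ :+ t′) := (s :- y :* s′) :+ (t :- y :* t′)) refl

  -- A finite form of 1 - y ≤ exp (- y). Since `exp` is a limit of partial sums, the estimate is
  -- made at a fixed truncation; passing from `expSum-suc` drops the nonnegative last term times y.
  expSum-shift : ∀ x y n → 0ℚ ≤ x → 0ℚ ≤ y → expSum (x + y) n * (1ℚ - y) ≤ expSum x n
  expSum-shift x y zero    0≤x 0≤y = ≤-reflexive (*-zeroˡ (1ℚ - y))
  expSum-shift x y (suc n) 0≤x 0≤y = ≤-trans
    (≤-byDifference _ (0≤* 0≤y (0≤expTerm n (0≤+ 0≤x 0≤y))) (identity (expSum (x + y) n) (expTerm (x + y) n) y))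
    (expSum-suc x y n 0≤x 0≤y)
    where
    identity : ∀ s t y → (s + t) * (1ℚ - y) + y * t ≡ s + t - y * s
    identity = solve 3 (λ s t y → (s :+ t) :* (con 1ℚ :- y) :+ y :* t := s :+ t :- y :* s) refl

  expSum-0 : ∀ n → expSum 0ℚ n ≤ 1ℚ
  expSum-0 zero          = 0≤1
  expSum-0 (suc zero)    = ≤-refl
  expSum-0 (suc (suc n)) = begin
    expSum 0ℚ (suc n) + 0ℚ * 0ℚ ^ℚ n * (1/! (suc n))  ≡⟨ solve 3 (λ s w f → s :+ con 0ℚ :* w :* f := s) refl (expSum 0ℚ (suc n)) (0ℚ ^ℚ n) ((1/! (suc n))) ⟩
    expSum 0ℚ (suc n)                             ≤⟨ expSum-0 (suc n) ⟩
    1ℚ                                            ∎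
    where open ≤-Reasoning

  -- Each application of `expSum-shift` removes one y from the exponent at the cost of one factor 1
  -- - y. The product form avoids a division by 1 - y.
  expSum-bound : ∀ y p n → 0ℚ ≤ y → y ≤ 1ℚ → expSum (p /1 * y) n * (1ℚ - y) ^ℚ p ≤ 1ℚ
  expSum-bound y zero    n 0≤y y≤1 = begin
    expSum (0ℚ * y) n * 1ℚ  ≡⟨ trans (*-identityʳ _) (cong (λ x → expSum x n) (*-zeroˡ y)) ⟩
    expSum 0ℚ n             ≤⟨ expSum-0 n ⟩
    1ℚ                      ∎
    where open ≤-Reasoning
  expSum-bound y (suc p) n 0≤y y≤1 = begin
    expSum (suc p /1 * y) n * ((1ℚ - y) * (1ℚ - y) ^ℚ p)
      ≡⟨ cong (λ x → expSum x n * ((1ℚ - y) * (1ℚ - y) ^ℚ p)) (trans (cong (_* y) (suc-/1 p)) (identity (p /1) y)) ⟩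
    expSum (p /1 * y + y) n * ((1ℚ - y) * (1ℚ - y) ^ℚ p)
      ≡⟨ *-assoc (expSum (p /1 * y + y) n) (1ℚ - y) ((1ℚ - y) ^ℚ p) ⟨
    expSum (p /1 * y + y) n * (1ℚ - y) * (1ℚ - y) ^ℚ p
      ≤⟨ *-monoʳ _ (0≤^ p (0≤y-x y≤1)) (expSum-shift (p /1 * y) y n (0≤* (0≤/1 p) 0≤y) 0≤y) ⟩
    expSum (p /1 * y) n * (1ℚ - y) ^ℚ p
      ≤⟨ expSum-bound y p n 0≤y y≤1 ⟩
    1ℚ ∎
    where
    open ≤-Reasoning
    identity : ∀ k y → (1ℚ + k) * y ≡ k * y + y
    identity = solve 2 (λ k y → (con 1ℚ :+ k) :* y := k :* y :+ y) refl

  /1-homo-^ : ∀ m n → (m ℕ.^ n) /1 ≡ (m /1) ^ℚ n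
  /1-homo-^ m zero    = refl
  /1-homo-^ m (suc n) = trans (/1-homo-* m (m ℕ.^ n)) (cong (m /1 *_) (/1-homo-^ m n))

  *-monoˡ-< : ∀ {x y} z → 0ℚ < z → x < y → z * x < z * y
  *-monoˡ-< z 0<z = *-monoʳ-<-pos z {{positive 0<z}}

  square-cancel-≤ : ∀ {x y} → 0ℚ ≤ y → x * x ≤ y * y → x ≤ y
  square-cancel-≤ {x} {y} 0≤y x²≤y² with x ≤? y
  ... | yes x≤y = x≤y
  ... | no  x≰y = contradiction refl (<⇒≢ (begin-strict
    y * y  ≤⟨ *-monoˡ y 0≤y (<⇒≤ y<x) ⟩
    y * x  ≡⟨ *-comm y x ⟩
    x * y  <⟨ *-monoˡ-< x (≤-<-trans 0≤y y<x) y<x ⟩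
    x * x  ≤⟨ x²≤y² ⟩
    y * y  ∎))
    where
    open ≤-Reasoning
    y<x : y < x
    y<x = ≰⇒> x≰y

  -- With c ν a₀ b₁ and c ν a₁ b₀ moved to one side this is (c - ν a₀ b₁) (c - ν a₁ b₀) ≥ 0, because
  -- (a₀ b₁) (a₁ b₀) = (a₀ b₀) (a₁ b₁) ≤ c².
  separated-step : ∀ a₀ a₁ b₀ b₁ c ν κ → 0ℚ < c → 0ℚ < ν → (1ℚ + ν) * (1ℚ + ν) ≤ κ * ν → 0ℚ ≤ a₀ * b₀ →
    a₀ * b₀ ≤ c → a₁ * b₁ ≤ c → ν * (a₀ * b₁) ≤ c → ν * (a₁ * b₀) ≤ c →
    (a₀ + a₁) * (b₀ + b₁) ≤ κ * c
  separated-step a₀ a₁ b₀ b₁ c ν κ 0<c 0<ν [1+ν]²≤κν 0≤a₀b₀ a₀b₀≤c a₁b₁≤c νa₀b₁≤c νa₁b₀≤c =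
    *-cancelʳ-≤-pos (ν * c) {{positive (*-pos 0<ν 0<c)}} (≤-byDifference _ 0≤difference identity)
    where
    0≤c : 0ℚ ≤ c
    0≤c = <⇒≤ 0<c
    0≤ν : 0ℚ ≤ ν
    0≤ν = <⇒≤ 0<ν
    0≤νc : 0ℚ ≤ ν * c
    0≤νc = 0≤* 0≤ν 0≤c
    0≤difference : 0ℚ ≤ (κ * ν - (1ℚ + ν) * (1ℚ + ν)) * (c * c) + ν * c * (c - a₀ * b₀) + ν * c * (c - a₁ * b₁)
      + (c - ν * (a₀ * b₁)) * (c - ν * (a₁ * b₀))
      -- The bracket is c² - (a₀ b₀) (a₁ b₁), written in terms of the given bounds.
      + ν * ν * (c * (c - a₀ * b₀) + a₀ * b₀ * (c - a₁ * b₁))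
    0≤difference = 0≤+ (0≤+ (0≤+ (0≤+
      (0≤* (0≤y-x [1+ν]²≤κν) (0≤* 0≤c 0≤c))
      (0≤* 0≤νc (0≤y-x a₀b₀≤c)))
      (0≤* 0≤νc (0≤y-x a₁b₁≤c)))
      (0≤* (0≤y-x νa₀b₁≤c) (0≤y-x νa₁b₀≤c)))
      (0≤* (0≤* 0≤ν 0≤ν) (0≤+ (0≤* 0≤c (0≤y-x a₀b₀≤c)) (0≤* 0≤a₀b₀ (0≤y-x a₁b₁≤c))))
    identity : _
    identity = solve 7 (λ a₀ a₁ b₀ b₁ c ν κ →
      (a₀ :+ a₁) :* (b₀ :+ b₁) :* (ν :* c) :+
      ((κ :* ν :- (con 1ℚ :+ ν) :* (con 1ℚ :+ ν)) :* (c :* c) :+ ν :* c :* (c :- a₀ :* b₀) :+ ν :* c :* (c :- a₁ :* b₁)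
        :+ (c :- ν :* (a₀ :* b₁)) :* (c :- ν :* (a₁ :* b₀))
        :+ ν :* ν :* (c :* (c :- a₀ :* b₀) :+ a₀ :* b₀ :* (c :- a₁ :* b₁)))
      := κ :* c :* (ν :* c)) refl a₀ a₁ b₀ b₁ c ν κ

  -- Choice of the parameters

  -- With δ = 1/100 the exponential in the theorem is that of p * w, and ω ≤ exp (p * w) ^ (- 2). The ratio ν is
  -- the square of 1 - φ; the optimal φ is about p / d, but 2 p / (5 d) is small enough for the bounds to hold
  -- for all p ≤ d and still exceeds the first-order terms n z + 4 w in 1-φ≤. The factor 16/9 in z is the value
  -- of (1 - φ / 2)² / (1 - φ)² at φ = 2/5.
  module Density (d p : ℕ) .{{_ : ℕ.NonZero d}} (p≤d : p ℕ.≤ d) where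

    ρ r φ z w ω ν κ : ℚ
    ρ = + 1 / d
    r = p /1 * ρ
    φ = (+ 2 / 5) * r
    z = (+ 16 / 9) * φ * ((+ 2 / 5) * ρ)
    w = (+ 101 / 1600) * r
    ω = ((1ℚ - w) * (1ℚ - w)) ^ℚ p
    ν = (1ℚ - φ) * (1ℚ - φ)
    κ = 4 /1 * (1ℚ + p /1 * z)

    0≤ρ : 0ℚ ≤ ρ
    0≤ρ = 0≤1/d d

    0≤r : 0ℚ ≤ r
    0≤r = 0≤* (0≤/1 p) 0≤ρ

    r≤1 : r ≤ 1ℚ
    r≤1 = begin
      p /1 * ρ  ≤⟨ *-monoʳ ρ 0≤ρ (/1-mono p≤d) ⟩
      d /1 * ρ  ≡⟨ trans (*-comm (d /1) ρ) (1/d*d≡1 d) ⟩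
      1ℚ        ∎
      where open ≤-Reasoning

    ρ≤1 : ρ ≤ 1ℚ
    ρ≤1 = begin
      ρ         ≡⟨ *-identityˡ ρ ⟨
      1 /1 * ρ  ≤⟨ *-monoʳ ρ 0≤ρ (/1-mono (ℕ.>-nonZero⁻¹ d)) ⟩
      d /1 * ρ  ≡⟨ trans (*-comm (d /1) ρ) (1/d*d≡1 d) ⟩
      1ℚ        ∎
      where open ≤-Reasoning

    0≤φ : 0ℚ ≤ φ
    0≤φ = 0≤* (nonNegative⁻¹ (+ 2 / 5)) 0≤r

    φ≤ : φ ≤ + 2 / 5
    φ≤ = *-monoˡ (+ 2 / 5) (nonNegative⁻¹ (+ 2 / 5)) r≤1

    0<1-φ : 0ℚ < 1ℚ - φ
    0<1-φ = <-≤-trans (positive⁻¹ (+ 3 / 5)) (+-monoʳ-≤ 1ℚ (neg-antimono-≤ φ≤))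

    1-φ≤1 : 1ℚ - φ ≤ 1ℚ
    1-φ≤1 = ≤-byDifference φ 0≤φ (solve 1 (λ φ → con 1ℚ :- φ :+ φ := con 1ℚ) refl φ)

    0≤z : 0ℚ ≤ z
    0≤z = 0≤* (0≤* (nonNegative⁻¹ (+ 16 / 9)) 0≤φ) (0≤* (nonNegative⁻¹ (+ 2 / 5)) 0≤ρ)

    z≤1 : z ≤ 1ℚ
    z≤1 = ≤-trans
      (*-mono (0≤* (nonNegative⁻¹ (+ 16 / 9)) 0≤φ) (0≤* (nonNegative⁻¹ (+ 2 / 5)) 0≤ρ)
        (*-monoˡ (+ 16 / 9) (nonNegative⁻¹ (+ 16 / 9)) φ≤) (*-monoˡ (+ 2 / 5) (nonNegative⁻¹ (+ 2 / 5)) ρ≤1))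
      (toWitness {a? = (+ 16 / 9) * (+ 2 / 5) * ((+ 2 / 5) * 1ℚ) ≤? 1ℚ} _)

    w≤1 : w ≤ 1ℚ
    w≤1 = ≤-trans (*-monoˡ (+ 101 / 1600) (nonNegative⁻¹ (+ 101 / 1600)) r≤1)
                  (toWitness {a? = (+ 101 / 1600) * 1ℚ ≤? 1ℚ} _)

    0≤w : 0ℚ ≤ w
    0≤w = 0≤* (nonNegative⁻¹ (+ 101 / 1600)) 0≤r

    0≤1-w : 0ℚ ≤ 1ℚ - w
    0≤1-w = 0≤y-x w≤1

    0≤ω : 0ℚ ≤ ω
    0≤ω = 0≤^ p (0≤* 0≤1-w 0≤1-w)

    -- Here p z = 16/9 φ², and κ ν - (1 + ν)² = 4 p z ν - (1 - ν)² with 1 - ν = φ (2 - φ). Hence the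
    -- difference is φ² (64/9 (1 - φ)² - (2 - φ)²); the second factor is a difference of squares and
    -- vanishes at φ = 2/5.
    [1+ν]²≤κν : (1ℚ + ν) * (1ℚ + ν) ≤ κ * ν
    [1+ν]²≤κν = ≤-byDifference
      (φ * φ * ((+ 5 / 3) * (+ 2 / 5 - φ) * ((+ 11 / 3) * (+ 2 / 5 - φ) + + 16 / 5)))
      (0≤* (0≤* 0≤φ 0≤φ) (0≤* (0≤* (nonNegative⁻¹ (+ 5 / 3)) (0≤y-x φ≤))
        (0≤+ (0≤* (nonNegative⁻¹ (+ 11 / 3)) (0≤y-x φ≤)) (nonNegative⁻¹ (+ 16 / 5)))))
      (solve 2 (λ p ρ →
        let φ = con (+ 2 / 5) :* (p :* ρ)
            ν = (con 1ℚ :- φ) :* (con 1ℚ :- φ)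
        in (con 1ℚ :+ ν) :* (con 1ℚ :+ ν) :+
           φ :* φ :* (con (+ 5 / 3) :* (con (+ 2 / 5) :- φ) :* (con (+ 11 / 3) :* (con (+ 2 / 5) :- φ) :+ con (+ 16 / 5)))
           := con (4 /1) :* (con 1ℚ :+ p :* (con (+ 16 / 9) :* φ :* (con (+ 2 / 5) :* ρ))) :* ν)
        refl (p /1) ρ)

    0<ν : 0ℚ < ν
    0<ν = *-pos 0<1-φ 0<1-φ

    ν≤1 : ν ≤ 1ℚ
    ν≤1 = *-mono (<⇒≤ 0<1-φ) (<⇒≤ 0<1-φ) 1-φ≤1 1-φ≤1

    0<κ : 0ℚ < κ
    0<κ = *-pos (positive⁻¹ (4 /1)) (<-≤-trans (positive⁻¹ 1ℚ) (≤-byDifference (p /1 * z) (0≤* (0≤/1 p) 0≤z) refl))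

    module _ (n : ℕ) (n≤ : 200 ℕ.* n ℕ.≤ 101 ℕ.* d) where

      s : ℚ
      s = n /1 * ρ

      0≤s : 0ℚ ≤ s
      0≤s = 0≤* (0≤/1 n) 0≤ρ

      s≤ : s ≤ + 101 / 200
      s≤ = *-cancelˡ-≤-pos (200 /1) (begin
        200 /1 * (n /1 * ρ)      ≡⟨ *-assoc (200 /1) (n /1) ρ ⟨
        200 /1 * n /1 * ρ        ≡⟨ cong (_* ρ) (/1-homo-* 200 n) ⟨
        (200 ℕ.* n) /1 * ρ       ≤⟨ *-monoʳ ρ 0≤ρ (/1-mono n≤) ⟩
        (101 ℕ.* d) /1 * ρ       ≡⟨ cong (_* ρ) (/1-homo-* 101 d) ⟩
        101 /1 * d /1 * ρ        ≡⟨ solve 2 (λ k ρ → con (101 /1) :* k :* ρ := con (101 /1) :* (ρ :* k)) refl (d /1) ρ ⟩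
        101 /1 * (ρ * d /1)      ≡⟨ cong (101 /1 *_) (1/d*d≡1 d) ⟩
        200 /1 * (+ 101 / 200)   ∎)
        where open ≤-Reasoning

      nz≡ : n /1 * z ≡ (+ 64 / 225) * (s * r)
      nz≡ = solve 3 (λ n p ρ → n :* (con (+ 16 / 9) :* (con (+ 2 / 5) :* (p :* ρ)) :* (con (+ 2 / 5) :* ρ)) :=
                               con (+ 64 / 225) :* (n :* ρ :* (p :* ρ))) refl (n /1) (p /1) ρ

      nz≤1 : n /1 * z ≤ 1ℚ
      nz≤1 = begin
        n /1 * z                     ≡⟨ nz≡ ⟩
        (+ 64 / 225) * (s * r)       ≤⟨ *-monoˡ (+ 64 / 225) (nonNegative⁻¹ (+ 64 / 225)) (*-mono 0≤s 0≤r s≤ r≤1) ⟩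
        (+ 64 / 225) * ((+ 101 / 200) * 1ℚ)  ≤⟨ toWitness {a? = (+ 64 / 225) * ((+ 101 / 200) * 1ℚ) ≤? 1ℚ} _ ⟩
        1ℚ                           ∎
        where open ≤-Reasoning

      -- What remains of φ / r = 2/5 after subtracting 4 w / r and the largest value of n z / r. The
      -- 101/400 comes from δ, the 101/200 from `s≤`.
      gap : ℚ
      gap = + 2 / 5 - + 101 / 400 - (+ 64 / 225) * (+ 101 / 200)

      -- Meant to be raised to the power p: then (1 - w)^(4 p) is ω², and (1 - n z)^p compensates (1
      -- + p z)^n.
      1-φ≤ : 1ℚ - φ ≤ (1ℚ - n /1 * z) * (1ℚ - w) ^ℚ 4
      1-φ≤ = begin
        1ℚ - φ
          ≤⟨ ≤-byDifference (r * ((+ 64 / 225) * (+ 101 / 200 - s) + gap) + (+ 64 / 225) * (s * r) * ((+ 101 / 400) * r))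
               (0≤+ (0≤* 0≤r (0≤+ (0≤* (nonNegative⁻¹ (+ 64 / 225)) (0≤y-x s≤)) (nonNegative⁻¹ gap)))
                    (0≤* (0≤* (nonNegative⁻¹ (+ 64 / 225)) (0≤* 0≤s 0≤r)) (0≤* (nonNegative⁻¹ (+ 101 / 400)) 0≤r)))
               (solve 2 (λ r s → con 1ℚ :- con (+ 2 / 5) :* r :+
                 (r :* (con (+ 64 / 225) :* (con (+ 101 / 200) :- s) :+ con gap) :+ con (+ 64 / 225) :* (s :* r) :* (con (+ 101 / 400) :* r))
                 := (con 1ℚ :- con (+ 64 / 225) :* (s :* r)) :* (con 1ℚ :+ con (4 /1) :* :- (con (+ 101 / 1600) :* r))) refl r s) ⟩
        (1ℚ - (+ 64 / 225) * (s * r)) * (1ℚ + 4 /1 * - w)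
          ≡⟨ cong (λ k → (1ℚ - k) * (1ℚ + 4 /1 * - w)) nz≡ ⟨
        (1ℚ - n /1 * z) * (1ℚ + 4 /1 * - w)
          ≤⟨ *-monoˡ (1ℚ - n /1 * z) (0≤y-x nz≤1) (bernoulli (- w) 4 0≤1-w) ⟩
        (1ℚ - n /1 * z) * (1ℚ - w) ^ℚ 4 ∎
        where open ≤-Reasoning

      -- Since ν^e = (1 - φ)^(2 e) ≤ (1 - φ)^p, `1-φ≤` brings in (1 - n z)^p ω², and `weighted-amgm`
      -- removes the factors other than 4^n ω². The result is left as a square, to be compared with
      -- |Q|².
      κ^n*ν^e≤ : ∀ e → p ℕ.≤ e ℕ.+ e →
        κ ^ℚ n * ν ^ℚ e ≤ ((2 /1) ^ℚ n * ω) * ((2 /1) ^ℚ n * ω)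
      κ^n*ν^e≤ e p≤2e = begin
        κ ^ℚ n * ν ^ℚ e
          ≡⟨ cong₂ _*_ (^-distrib-* (4 /1) (1ℚ + p /1 * z) n)
               (trans (^-distrib-* (1ℚ - φ) (1ℚ - φ) e) (sym (^-homo-* (1ℚ - φ) e e))) ⟩
        (4 /1) ^ℚ n * (1ℚ + p /1 * z) ^ℚ n * (1ℚ - φ) ^ℚ (e ℕ.+ e)
          ≤⟨ *-monoˡ _ 0≤lhs (≤-trans (^-antitone (<⇒≤ 0<1-φ) 1-φ≤1 p≤2e) (^-monoˡ p (<⇒≤ 0<1-φ) 1-φ≤)) ⟩
        (4 /1) ^ℚ n * (1ℚ + p /1 * z) ^ℚ n * ((1ℚ - n /1 * z) * (1ℚ - w) ^ℚ 4) ^ℚ p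
          ≡⟨ cong ((4 /1) ^ℚ n * (1ℚ + p /1 * z) ^ℚ n *_) (^-distrib-* (1ℚ - n /1 * z) ((1ℚ - w) ^ℚ 4) p) ⟩
        (4 /1) ^ℚ n * (1ℚ + p /1 * z) ^ℚ n * ((1ℚ - n /1 * z) ^ℚ p * ((1ℚ - w) ^ℚ 4) ^ℚ p)
          ≡⟨ regroup ((4 /1) ^ℚ n) ((1ℚ + p /1 * z) ^ℚ n) ((1ℚ - n /1 * z) ^ℚ p) (((1ℚ - w) ^ℚ 4) ^ℚ p) ⟩
        (1ℚ + p /1 * z) ^ℚ n * (1ℚ - n /1 * z) ^ℚ p * ((4 /1) ^ℚ n * ((1ℚ - w) ^ℚ 4) ^ℚ p)
          ≤⟨ *-monoʳ _ (0≤* (0≤^ n (0≤/1 4)) (0≤^ p (0≤^ 4 0≤1-w))) (weighted-amgm z n p 0≤z z≤1 nz≤1) ⟩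
        1ℚ * ((4 /1) ^ℚ n * ((1ℚ - w) ^ℚ 4) ^ℚ p)
          ≡⟨ cong (1ℚ *_) (cong₂ _*_ (^-distrib-* (2 /1) (2 /1) n)
               (trans (cong (_^ℚ p) (solve 1 (λ y → y :* (y :* (y :* (y :* con 1ℚ))) := (y :* y) :* (y :* y)) refl (1ℚ - w)))
                 (^-distrib-* ((1ℚ - w) * (1ℚ - w)) ((1ℚ - w) * (1ℚ - w)) p))) ⟩
        1ℚ * ((2 /1) ^ℚ n * (2 /1) ^ℚ n * (ω * ω))
          ≡⟨ solve 2 (λ a b → con 1ℚ :* (a :* a :* (b :* b)) := a :* b :* (a :* b)) refl ((2 /1) ^ℚ n) ω ⟩
        ((2 /1) ^ℚ n * ω) * ((2 /1) ^ℚ n * ω) ∎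
        where
        open ≤-Reasoning
        0≤lhs : 0ℚ ≤ (4 /1) ^ℚ n * (1ℚ + p /1 * z) ^ℚ n
        0≤lhs = 0≤* (0≤^ n (0≤/1 4)) (0≤^ n (0≤+ 0≤1 (0≤* (0≤/1 p) 0≤z)))
        regroup : ∀ a b c d → a * b * (c * d) ≡ b * c * (a * d)
        regroup = solve 4 (λ a b c d → a :* b :* (c :* d) := b :* c :* (a :* d)) refl

-- Sums over the hypercube

open import Data.Nat using (_+_; _*_; _∸_; _^_; _≤_; _>_)
open import Data.Nat.Properties

private variable
  d n : ℕ

∑ : (Vertex n → ℕ) → ℕ
∑ {zero}  f = f []
∑ {suc n} f = ∑ (f ∘ (false ∷_)) + ∑ (f ∘ (true ∷_))

∑-cong : {f g : Vertex n → ℕ} → (∀ v → f v ≡ g v) → ∑ f ≡ ∑ g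
∑-cong {zero}  f≗g = f≗g []
∑-cong {suc n} f≗g = cong₂ _+_ (∑-cong (f≗g ∘ (false ∷_))) (∑-cong (f≗g ∘ (true ∷_)))

+-interchange : ∀ a b c d → (a + b) + (c + d) ≡ (a + c) + (b + d)
+-interchange = solve-∀

∑-+ : (f g : Vertex n → ℕ) → ∑ (λ v → f v + g v) ≡ ∑ f + ∑ g
∑-+ {zero}  f g = refl
∑-+ {suc n} f g = trans (cong₂ _+_ (∑-+ (f ∘ (false ∷_)) (g ∘ (false ∷_))) (∑-+ (f ∘ (true ∷_)) (g ∘ (true ∷_))))
  (+-interchange (∑ (f ∘ (false ∷_))) _ _ _)

∑-*ˡ : ∀ k (f : Vertex n → ℕ) → ∑ (λ v → k * f v) ≡ k * ∑ f
∑-*ˡ {zero}  k f = refl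
∑-*ˡ {suc n} k f = trans (cong₂ _+_ (∑-*ˡ k (f ∘ (false ∷_))) (∑-*ˡ k (f ∘ (true ∷_)))) (sym (*-distribˡ-+ k _ _))

∑-complement : (f : Vertex n → ℕ) → ∑ (f ∘ map not) ≡ ∑ f
∑-complement {zero}  f = refl
∑-complement {suc n} f = trans (+-comm (∑ (λ v → f (true ∷ map not v))) _)
  (cong₂ _+_ (∑-complement (f ∘ (false ∷_))) (∑-complement (f ∘ (true ∷_))))

∑-1 : ∑ {n} (λ _ → 1) ≡ 2 ^ n
∑-1 {zero}  = refl
∑-1 {suc n} = trans (cong₂ _+_ (∑-1 {n}) (∑-1 {n})) (cong (λ k → 2 ^ n + k) (sym (+-identityʳ (2 ^ n))))

∑² : (Vertex n → Vertex n → ℕ) → ℕ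
∑² F = ∑ (λ a → ∑ (F a))

∑²-suc : (F : Vertex (suc n) → Vertex (suc n) → ℕ) → ∑² F ≡
  (∑² (λ a b → F (false ∷ a) (false ∷ b)) + ∑² (λ a b → F (false ∷ a) (true ∷ b))) +
  (∑² (λ a b → F (true ∷ a) (false ∷ b)) + ∑² (λ a b → F (true ∷ a) (true ∷ b)))
∑²-suc F = cong₂ _+_ (∑-+ (λ a → ∑ (F (false ∷ a) ∘ (false ∷_))) _) (∑-+ (λ a → ∑ (F (true ∷ a) ∘ (false ∷_))) _)

𝟙 : Bool → ℕ
𝟙 b = if b then 1 else 0

𝟙-∧ : ∀ x y → 𝟙 (x ∧ y) ≡ 𝟙 x * 𝟙 y
𝟙-∧ false y = refl
𝟙-∧ true  y = sym (+-identityʳ (𝟙 y))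

length-filterᵇ-map : ∀ {A B : Set} (p : B → Bool) (f : A → B) xs →
  length (filterᵇ p (List.map f xs)) ≡ length (filterᵇ (p ∘ f) xs)
length-filterᵇ-map p f List.[]       = refl
length-filterᵇ-map p f (x List.∷ xs) with p (f x)
... | false = length-filterᵇ-map p f xs
... | true  = cong suc (length-filterᵇ-map p f xs)

∣∣≡∑ : (A : VertexSet n) → ∣ A ∣ ≡ ∑ (𝟙 ∘ A)
∣∣≡∑ {zero}  A with A []
... | false = refl
... | true  = refl
∣∣≡∑ {suc n} A = begin
  length (filterᵇ A (List.map (false ∷_) (vertices n) List.++ List.map (true ∷_) (vertices n)))
    ≡⟨ cong length (filter-++ (T? ∘ A) (List.map (false ∷_) (vertices n)) _) ⟩
  length (filterᵇ A (List.map (false ∷_) (vertices n)) List.++ filterᵇ A (List.map (true ∷_) (vertices n)))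
    ≡⟨ length-++ (filterᵇ A (List.map (false ∷_) (vertices n))) ⟩
  length (filterᵇ A (List.map (false ∷_) (vertices n))) + length (filterᵇ A (List.map (true ∷_) (vertices n)))
    ≡⟨ cong₂ _+_ (length-filterᵇ-map A (false ∷_) (vertices n)) (length-filterᵇ-map A (true ∷_) (vertices n)) ⟩
  ∣ A ∘ (false ∷_) ∣ + ∣ A ∘ (true ∷_) ∣
    ≡⟨ cong₂ _+_ (∣∣≡∑ (A ∘ (false ∷_))) (∣∣≡∑ (A ∘ (true ∷_))) ⟩
  ∑ (𝟙 ∘ A) ∎
  where open ≡-Reasoning

∣∣-suc : (A : VertexSet (suc n)) → ∣ A ∣ ≡ ∣ A ∘ (false ∷_) ∣ + ∣ A ∘ (true ∷_) ∣
∣∣-suc A = trans (∣∣≡∑ A) (sym (cong₂ _+_ (∣∣≡∑ (A ∘ (false ∷_))) (∣∣≡∑ (A ∘ (true ∷_)))))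

∣∣*∣∣≡∑² : (A B : VertexSet n) → ∣ A ∣ * ∣ B ∣ ≡ ∑² (λ a b → 𝟙 (A a ∧ B b))
∣∣*∣∣≡∑² A B = begin
  ∣ A ∣ * ∣ B ∣                        ≡⟨ cong₂ _*_ (∣∣≡∑ A) (∣∣≡∑ B) ⟩
  ∑ (𝟙 ∘ A) * ∑ (𝟙 ∘ B)                ≡⟨ *-comm (∑ (𝟙 ∘ A)) _ ⟩
  ∑ (𝟙 ∘ B) * ∑ (𝟙 ∘ A)                ≡⟨ ∑-*ˡ (∑ (𝟙 ∘ B)) (𝟙 ∘ A) ⟨
  ∑ (λ a → ∑ (𝟙 ∘ B) * 𝟙 (A a))        ≡⟨ ∑-cong (λ a → trans (*-comm (∑ (𝟙 ∘ B)) (𝟙 (A a))) (sym (∑-*ˡ (𝟙 (A a)) (𝟙 ∘ B)))) ⟩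
  ∑² (λ a b → 𝟙 (A a) * 𝟙 (B b))       ≡⟨ ∑-cong (λ a → ∑-cong (λ b → 𝟙-∧ (A a) (B b))) ⟨
  ∑² (λ a b → 𝟙 (A a ∧ B b))           ∎
  where open ≡-Reasoning

nonempty⊎∣∣≡0 : (A : VertexSet n) → Nonempty A ⊎ ∣ A ∣ ≡ 0
nonempty⊎∣∣≡0 {zero}  A with A [] in eq
... | false = inj₂ refl
... | true  = inj₁ ([] , eq)
nonempty⊎∣∣≡0 {suc n} A with nonempty⊎∣∣≡0 (A ∘ (false ∷_)) | nonempty⊎∣∣≡0 (A ∘ (true ∷_))
... | inj₁ (v , Av) | _             = inj₁ (false ∷ v , Av)
... | inj₂ _        | inj₁ (v , Av) = inj₁ (true ∷ v , Av)
... | inj₂ e₀       | inj₂ e₁       = inj₂ (trans (∣∣-suc A) (cong₂ _+_ e₀ e₁))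

-- Sizes of separated sets

Separated : ℕ → VertexSet n → VertexSet n → Set
Separated e A B = ∀ a b → A a ≡ true → B b ≡ true → e ≤ hamming a b

-- Split both sets by the first coordinate: halves with equal first bits remain at distance e,
-- halves with different ones at distance e - 1. `separated-step` combines the four products.
separated-bound : ∀ ν κ e (A B : VertexSet n) → 0ℚ ℚ.< ν → ν ℚ.≤ 1ℚ → 0ℚ ℚ.< κ →
  (1ℚ ℚ.+ ν) ℚ.* (1ℚ ℚ.+ ν) ℚ.≤ κ ℚ.* ν → Separated e A B →
  ∣ A ∣ /1 ℚ.* ∣ B ∣ /1 ℚ.≤ κ ^ℚ n ℚ.* ν ^ℚ e
separated-bound {zero} ν κ e A B 0<ν ν≤1 0<κ [1+ν]²≤κν sep with A [] in eqA | B [] in eqB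
... | false | false = ℚ.≤-trans (0≤^ e (ℚ.<⇒≤ 0<ν)) (ℚ.≤-reflexive (sym (ℚ.*-identityˡ _)))
... | false | true  = ℚ.≤-trans (0≤^ e (ℚ.<⇒≤ 0<ν)) (ℚ.≤-reflexive (sym (ℚ.*-identityˡ _)))
... | true  | false = ℚ.≤-trans (0≤^ e (ℚ.<⇒≤ 0<ν)) (ℚ.≤-reflexive (sym (ℚ.*-identityˡ _)))
-- Both sets contain the only vertex, so e = 0 and both sides are 1.
... | true  | true  with z≤n ← sep [] [] eqA eqB = ℚ.≤-refl
separated-bound {suc n} ν κ e A B 0<ν ν≤1 0<κ [1+ν]²≤κν sep = begin
  ∣ A ∣ /1 ℚ.* ∣ B ∣ /1
    ≡⟨ cong₂ ℚ._*_ (split A) (split B) ⟩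
  (∣ A₀ ∣ /1 ℚ.+ ∣ A₁ ∣ /1) ℚ.* (∣ B₀ ∣ /1 ℚ.+ ∣ B₁ ∣ /1)
    ≤⟨ separated-step (∣ A₀ ∣ /1) (∣ A₁ ∣ /1) (∣ B₀ ∣ /1) (∣ B₁ ∣ /1) (κ ^ℚ n ℚ.* ν ^ℚ e) ν κ
         (*-pos (^-pos n 0<κ) (^-pos e 0<ν)) 0<ν [1+ν]²≤κν (0≤* (0≤/1 ∣ A₀ ∣) (0≤/1 ∣ B₀ ∣))
         (IH e A₀ B₀ (λ a b → sep (false ∷ a) (false ∷ b))) (IH e A₁ B₁ (λ a b → sep (true ∷ a) (true ∷ b)))
         (across A₀ B₁ (λ a b Aa Bb → ∸-monoˡ-≤ 1 (sep (false ∷ a) (true ∷ b) Aa Bb)))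
         (across A₁ B₀ (λ a b Aa Bb → ∸-monoˡ-≤ 1 (sep (true ∷ a) (false ∷ b) Aa Bb))) ⟩
  κ ℚ.* (κ ^ℚ n ℚ.* ν ^ℚ e)
    ≡⟨ ℚ.*-assoc κ (κ ^ℚ n) (ν ^ℚ e) ⟨
  κ ^ℚ suc n ℚ.* ν ^ℚ e ∎
  where
  open ℚ.≤-Reasoning
  A₀ A₁ B₀ B₁ : VertexSet n
  A₀ = A ∘ (false ∷_)
  A₁ = A ∘ (true ∷_)
  B₀ = B ∘ (false ∷_)
  B₁ = B ∘ (true ∷_)
  split : ∀ (C : VertexSet (suc n)) → ∣ C ∣ /1 ≡ ∣ C ∘ (false ∷_) ∣ /1 ℚ.+ ∣ C ∘ (true ∷_) ∣ /1
  split C = trans (cong _/1 (∣∣-suc C)) (/1-homo-+ ∣ C ∘ (false ∷_) ∣ ∣ C ∘ (true ∷_) ∣)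
  IH : ∀ e (C D : VertexSet n) → Separated e C D → ∣ C ∣ /1 ℚ.* ∣ D ∣ /1 ℚ.≤ κ ^ℚ n ℚ.* ν ^ℚ e
  IH e C D = separated-bound ν κ e C D 0<ν ν≤1 0<κ [1+ν]²≤κν
  ν*ν^[e-1]≤ν^e : ∀ e → ν ℚ.* ν ^ℚ (e ∸ 1) ℚ.≤ ν ^ℚ e
  -- For e = 0 the truncated e ∸ 1 is again 0, and ν ≤ 1 gives the bound.
  ν*ν^[e-1]≤ν^e zero    = subst (ℚ._≤ 1ℚ) (sym (ℚ.*-identityʳ ν)) ν≤1
  ν*ν^[e-1]≤ν^e (suc e) = ℚ.≤-refl
  across : (C D : VertexSet n) → Separated (e ∸ 1) C D → ν ℚ.* (∣ C ∣ /1 ℚ.* ∣ D ∣ /1) ℚ.≤ κ ^ℚ n ℚ.* ν ^ℚ e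
  across C D sepCD = begin
    ν ℚ.* (∣ C ∣ /1 ℚ.* ∣ D ∣ /1)          ≤⟨ *-monoˡ ν (ℚ.<⇒≤ 0<ν) (IH (e ∸ 1) C D sepCD) ⟩
    ν ℚ.* (κ ^ℚ n ℚ.* ν ^ℚ (e ∸ 1))        ≡⟨ swapˡ ν (κ ^ℚ n) (ν ^ℚ (e ∸ 1)) ⟩
    κ ^ℚ n ℚ.* (ν ℚ.* ν ^ℚ (e ∸ 1))        ≤⟨ *-monoˡ (κ ^ℚ n) (0≤^ n (ℚ.<⇒≤ 0<κ)) (ν*ν^[e-1]≤ν^e e) ⟩
    κ ^ℚ n ℚ.* ν ^ℚ e                      ∎
    where
    swapˡ : ∀ x y z → x ℚ.* (y ℚ.* z) ≡ y ℚ.* (x ℚ.* z)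
    swapˡ x y z = trans (sym (ℚ.*-assoc x y z)) (trans (cong (ℚ._* z) (ℚ.*-comm x y)) (ℚ.*-assoc y x z))

-- Classes of pairs of vertices

-- Pairs of vertices are grouped by pairing up consecutive coordinates in which they differ. A class
-- `c : Paired d n` has n such pairs (the last one may lack its second coordinate) and the n free bits σ tell
-- for each of them which vertex takes which side: the members are paired c σ and paired c (map not σ). In
-- `Pending d n` the first coordinate of a pair has been read, and its bit x is still needed for the second.
mutual
  data Paired : ℕ → ℕ → Set where
    []    : Paired 0 0
    same  : Bool → Paired d n → Paired (suc d) n
    first : Pending d n → Paired (suc d) (suc n)

  data Pending : ℕ → ℕ → Set where
    []     : Pending 0 0
    same   : Bool → Pending d n → Pending (suc d) n
    second : Bool → Paired d n → Pending (suc d) n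

-- The flag f exchanges the second coordinates of all pairs. The members of a class for f = true are halfway
-- between those for f = false.
mutual
  paired : Bool → Paired d n → Vertex n → Vertex d
  paired f []         σ       = []
  paired f (same b c) σ       = b ∷ paired f c σ
  paired f (first c)  (x ∷ σ) = x ∷ pending f c x σ

  pending : Bool → Pending d n → Bool → Vertex n → Vertex d
  pending f []           x σ = []
  pending f (same b c)   x σ = b ∷ pending f c x σ
  -- For f = false, b is the xor of the two coordinates of the pair. The class fixes it while x
  -- varies.
  pending f (second b c) x σ = ((f xor b) xor x) ∷ paired f c σ

mutual
  -- The last pair may lack its second coordinate, hence `suc d`. In a pending class n counts only
  -- the pairs after the open one, whose first coordinate is no longer among the d.
  paired-size : Paired d n → n + n ≤ suc d
  paired-size []                     = z≤n
  paired-size (same b c)             = m≤n⇒m≤1+n (paired-size c)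
  paired-size {suc d} {suc n} (first c) = s≤s (subst (_≤ suc d) (sym (+-suc n n)) (s≤s (pending-size c)))

  pending-size : Pending d n → n + n ≤ d
  pending-size []           = z≤n
  pending-size (same b c)   = m≤n⇒m≤1+n (pending-size c)
  pending-size (second b c) = paired-size c

mutual
  -- The number n of pairs varies with the class, so the summand is polymorphic in n.
  ∑ᴾ : ∀ d → (∀ {n} → Paired d n → ℕ) → ℕ
  ∑ᴾ zero    F = F []
  ∑ᴾ (suc d) F = (∑ᴾ d (F ∘ same false) + ∑ᴾ d (F ∘ same true)) + ∑ᴼ d (F ∘ first)

  ∑ᴼ : ∀ d → (∀ {n} → Pending d n → ℕ) → ℕ
  ∑ᴼ zero    F = F []
  ∑ᴼ (suc d) F = (∑ᴼ d (F ∘ same false) + ∑ᴼ d (F ∘ same true)) + (∑ᴾ d (F ∘ second false) + ∑ᴾ d (F ∘ second true))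

mutual
  ∑ᴾ-+ : ∀ d (F G : ∀ {n} → Paired d n → ℕ) → ∑ᴾ d (λ c → F c + G c) ≡ ∑ᴾ d F + ∑ᴾ d G
  ∑ᴾ-+ zero    F G = refl
  ∑ᴾ-+ (suc d) F G = trans
    (cong₂ _+_ (trans (cong₂ _+_ (∑ᴾ-+ d (F ∘ same false) (G ∘ same false)) (∑ᴾ-+ d (F ∘ same true) (G ∘ same true)))
                      (+-interchange (∑ᴾ d (F ∘ same false)) _ _ _))
               (∑ᴼ-+ d (F ∘ first) (G ∘ first)))
    (+-interchange (∑ᴾ d (F ∘ same false) + ∑ᴾ d (F ∘ same true)) _ _ _)

  ∑ᴼ-+ : ∀ d (F G : ∀ {n} → Pending d n → ℕ) → ∑ᴼ d (λ c → F c + G c) ≡ ∑ᴼ d F + ∑ᴼ d G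
  ∑ᴼ-+ zero    F G = refl
  ∑ᴼ-+ (suc d) F G = trans
    (cong₂ _+_ (trans (cong₂ _+_ (∑ᴼ-+ d (F ∘ same false) (G ∘ same false)) (∑ᴼ-+ d (F ∘ same true) (G ∘ same true)))
                      (+-interchange (∑ᴼ d (F ∘ same false)) _ _ _))
               (trans (cong₂ _+_ (∑ᴾ-+ d (F ∘ second false) (G ∘ second false)) (∑ᴾ-+ d (F ∘ second true) (G ∘ second true)))
                      (+-interchange (∑ᴾ d (F ∘ second false)) _ _ _)))
    (+-interchange (∑ᴼ d (F ∘ same false) + ∑ᴼ d (F ∘ same true)) _ _ _)

+-scaled : ∀ {a b m n ω} → a /1 ℚ.≤ m /1 ℚ.* ω → b /1 ℚ.≤ n /1 ℚ.* ω → (a + b) /1 ℚ.≤ (m + n) /1 ℚ.* ω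
+-scaled {a} {b} {m} {n} {ω} a≤ b≤ = begin
  (a + b) /1                          ≡⟨ /1-homo-+ a b ⟩
  a /1 ℚ.+ b /1                       ≤⟨ ℚ.+-mono-≤ a≤ b≤ ⟩
  m /1 ℚ.* ω ℚ.+ n /1 ℚ.* ω           ≡⟨ ℚ.*-distribʳ-+ ω (m /1) (n /1) ⟨
  (m /1 ℚ.+ n /1) ℚ.* ω               ≡⟨ cong (ℚ._* ω) (/1-homo-+ m n) ⟨
  (m + n) /1 ℚ.* ω                    ∎
  where open ℚ.≤-Reasoning

mutual
  ∑ᴾ-scaled : ∀ d ω (F G : ∀ {n} → Paired d n → ℕ) → (∀ {n} (c : Paired d n) → F c /1 ℚ.≤ G c /1 ℚ.* ω) →
    ∑ᴾ d F /1 ℚ.≤ ∑ᴾ d G /1 ℚ.* ω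
  ∑ᴾ-scaled zero    ω F G F≤G = F≤G []
  ∑ᴾ-scaled (suc d) ω F G F≤G = +-scaled {∑ᴾ d (F ∘ same false) + _} {_} {∑ᴾ d (G ∘ same false) + _}
    (+-scaled {∑ᴾ d (F ∘ same false)} {_} {∑ᴾ d (G ∘ same false)}
      (∑ᴾ-scaled d ω (F ∘ same false) (G ∘ same false) (F≤G ∘ same false))
      (∑ᴾ-scaled d ω (F ∘ same true) (G ∘ same true) (F≤G ∘ same true)))
    (∑ᴼ-scaled d ω (F ∘ first) (G ∘ first) (F≤G ∘ first))

  ∑ᴼ-scaled : ∀ d ω (F G : ∀ {n} → Pending d n → ℕ) → (∀ {n} (c : Pending d n) → F c /1 ℚ.≤ G c /1 ℚ.* ω) →
    ∑ᴼ d F /1 ℚ.≤ ∑ᴼ d G /1 ℚ.* ω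
  ∑ᴼ-scaled zero    ω F G F≤G = F≤G []
  ∑ᴼ-scaled (suc d) ω F G F≤G = +-scaled {∑ᴼ d (F ∘ same false) + _} {_} {∑ᴼ d (G ∘ same false) + _}
    (+-scaled {∑ᴼ d (F ∘ same false)} {_} {∑ᴼ d (G ∘ same false)}
      (∑ᴼ-scaled d ω (F ∘ same false) (G ∘ same false) (F≤G ∘ same false))
      (∑ᴼ-scaled d ω (F ∘ same true) (G ∘ same true) (F≤G ∘ same true)))
    (+-scaled {∑ᴾ d (F ∘ second false)} {_} {∑ᴾ d (G ∘ second false)}
      (∑ᴾ-scaled d ω (F ∘ second false) (G ∘ second false) (F≤G ∘ second false))
      (∑ᴾ-scaled d ω (F ∘ second true) (G ∘ second true) (F≤G ∘ second true)))

shuffle : ∀ w x y z → (w + x) + (y + z) ≡ (w + z) + (x + y)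
shuffle = solve-∀

mutual
  -- The classes partition all pairs of vertices for either value of f. Thus sums over the same
  -- index set express |S| |T| with f = false and |m̂(S,T)|² with f = true.
  ∑²-paired : ∀ f d (F : Vertex d → Vertex d → ℕ) →
    ∑² F ≡ ∑ᴾ d (λ c → ∑ (λ σ → F (paired f c σ) (paired f c (map not σ))))
  ∑²-paired f zero    F = refl
  ∑²-paired f (suc d) F = begin
    ∑² F
      ≡⟨ ∑²-suc F ⟩
    (∑² (λ a b → F (false ∷ a) (false ∷ b)) + ∑² (λ a b → F (false ∷ a) (true ∷ b))) +
    (∑² (λ a b → F (true ∷ a) (false ∷ b)) + ∑² (λ a b → F (true ∷ a) (true ∷ b)))
      ≡⟨ shuffle (∑² (λ a b → F (false ∷ a) (false ∷ b))) _ _ _ ⟩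
    (∑² (λ a b → F (false ∷ a) (false ∷ b)) + ∑² (λ a b → F (true ∷ a) (true ∷ b))) +
    (∑² (λ a b → F (false ∷ a) (true ∷ b)) + ∑² (λ a b → F (true ∷ a) (false ∷ b)))
      ≡⟨ cong₂ _+_ (cong₂ _+_ (∑²-paired f d _) (∑²-paired f d _)) (∑²-pending f d _ _) ⟩
    ∑ᴾ (suc d) (λ c → ∑ (λ σ → F (paired f c σ) (paired f c (map not σ)))) ∎
    where open ≡-Reasoning

  -- Two summands are carried because the first bit of the open pair is still to be chosen: F
  -- belongs to the bit false, G to true.
  ∑²-pending : ∀ f d (F G : Vertex d → Vertex d → ℕ) → ∑² F + ∑² G ≡
    ∑ᴼ d (λ c → ∑ (λ σ → F (pending f c false σ) (pending f c true (map not σ))) +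
                ∑ (λ σ → G (pending f c true σ) (pending f c false (map not σ))))
  ∑²-pending f zero    F G = refl
  ∑²-pending f (suc d) F G = begin
    ∑² F + ∑² G
      ≡⟨ cong₂ _+_ (∑²-suc F) (∑²-suc G) ⟩
    (F₀₀ + F₀₁ + (F₁₀ + F₁₁)) + (G₀₀ + G₀₁ + (G₁₀ + G₁₁))
      ≡⟨ regroup F₀₀ F₀₁ F₁₀ F₁₁ G₀₀ G₀₁ G₁₀ G₁₁ ⟩
    ((F₀₀ + G₀₀) + (F₁₁ + G₁₁)) + ((F₀₁ + G₁₀) + (F₁₀ + G₀₁))
      ≡⟨ cong₂ _+_ (cong₂ _+_ (∑²-pending f d _ _) (∑²-pending f d _ _)) (seconds f) ⟩
    ∑ᴼ (suc d) (λ c → ∑ (λ σ → F (pending f c false σ) (pending f c true (map not σ))) +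
                      ∑ (λ σ → G (pending f c true σ) (pending f c false (map not σ)))) ∎
    where
    open ≡-Reasoning
    F₀₀ F₀₁ F₁₀ F₁₁ G₀₀ G₀₁ G₁₀ G₁₁ : ℕ
    F₀₀ = ∑² (λ a b → F (false ∷ a) (false ∷ b))
    F₀₁ = ∑² (λ a b → F (false ∷ a) (true ∷ b))
    F₁₀ = ∑² (λ a b → F (true ∷ a) (false ∷ b))
    F₁₁ = ∑² (λ a b → F (true ∷ a) (true ∷ b))
    G₀₀ = ∑² (λ a b → G (false ∷ a) (false ∷ b))
    G₀₁ = ∑² (λ a b → G (false ∷ a) (true ∷ b))
    G₁₀ = ∑² (λ a b → G (true ∷ a) (false ∷ b))
    G₁₁ = ∑² (λ a b → G (true ∷ a) (true ∷ b))
    regroup : ∀ a b c d e f g h →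
      (a + b + (c + d)) + (e + f + (g + h)) ≡ ((a + e) + (d + h)) + ((b + g) + (c + f))
    regroup = solve-∀
    both : ∀ f (F G : Vertex d → Vertex d → ℕ) → ∑² F + ∑² G ≡
      ∑ᴾ d (λ c → ∑ (λ σ → F (paired f c σ) (paired f c (map not σ))) +
                  ∑ (λ σ → G (paired f c σ) (paired f c (map not σ))))
    both f F G = trans (cong₂ _+_ (∑²-paired f d F) (∑²-paired f d G)) (sym (∑ᴾ-+ d _ _))
    seconds : ∀ f → (F₀₁ + G₁₀) + (F₁₀ + G₀₁) ≡
      ∑ᴾ d (λ c → ∑ (λ σ → F (((f xor false) xor false) ∷ paired f c σ) (((f xor false) xor true) ∷ paired f c (map not σ))) +
                  ∑ (λ σ → G (((f xor false) xor true) ∷ paired f c σ) (((f xor false) xor false) ∷ paired f c (map not σ)))) +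
      ∑ᴾ d (λ c → ∑ (λ σ → F (((f xor true) xor false) ∷ paired f c σ) (((f xor true) xor true) ∷ paired f c (map not σ))) +
                  ∑ (λ σ → G (((f xor true) xor true) ∷ paired f c σ) (((f xor true) xor false) ∷ paired f c (map not σ))))
    seconds false = cong₂ _+_ (both false _ _) (both false _ _)
    -- Under f = true the values b = false and b = true exchange roles.
    seconds true  = trans (+-comm (F₀₁ + G₁₀) _) (cong₂ _+_ (both true _ _) (both true _ _))

-- Hamming distances and midpoints of a class

mismatch : Bool → Bool → ℕ
mismatch x y = 𝟙 (x xor y)

hamming-∷ : ∀ x y (a b : Vertex n) → hamming (x ∷ a) (y ∷ b) ≡ mismatch x y + hamming a b
hamming-∷ false false a b = refl
hamming-∷ false true  a b = refl
hamming-∷ true  false a b = refl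
hamming-∷ true  true  a b = refl

hamming-same : ∀ x (a b : Vertex n) → hamming (x ∷ a) (x ∷ b) ≡ hamming a b
hamming-same false a b = refl
hamming-same true  a b = refl

mismatch-xorˡ : ∀ b x y → mismatch (b xor x) (b xor y) ≡ mismatch x y
mismatch-xorˡ false x     y     = refl
mismatch-xorˡ true  false false = refl
mismatch-xorˡ true  false true  = refl
mismatch-xorˡ true  true  false = refl
mismatch-xorˡ true  true  true  = refl

mutual
  -- A bit where σ and τ differ changes both coordinates of its pair, or the only one if the last
  -- pair is incomplete.
  hamming-paired : ∀ f (c : Paired d n) σ τ →
    hamming (paired f c σ) (paired f c τ) ≤ hamming σ τ + hamming σ τ
  hamming-paired f []         σ       τ       = z≤n
  hamming-paired f (same b c) σ       τ       =
    ≤-trans (≤-reflexive (hamming-same b (paired f c σ) (paired f c τ))) (hamming-paired f c σ τ)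
  hamming-paired f (first c)  (x ∷ σ) (y ∷ τ) = begin
    hamming (x ∷ pending f c x σ) (y ∷ pending f c y τ)             ≡⟨ hamming-∷ x y (pending f c x σ) (pending f c y τ) ⟩
    mismatch x y + hamming (pending f c x σ) (pending f c y τ)      ≤⟨ +-monoʳ-≤ (mismatch x y) (hamming-pending f c x y σ τ) ⟩
    mismatch x y + (mismatch x y + (hamming σ τ + hamming σ τ))     ≡⟨ +-assoc (mismatch x y) (mismatch x y) _ ⟨
    mismatch x y + mismatch x y + (hamming σ τ + hamming σ τ)       ≡⟨ +-interchange (mismatch x y) _ _ _ ⟩
    mismatch x y + hamming σ τ + (mismatch x y + hamming σ τ)       ≡⟨ cong₂ _+_ (hamming-∷ x y σ τ) (hamming-∷ x y σ τ) ⟨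
    hamming (x ∷ σ) (y ∷ τ) + hamming (x ∷ σ) (y ∷ τ)               ∎
    where open ≤-Reasoning

  -- The first coordinate of the open pair is already counted; `mismatch x y` accounts for its
  -- second.
  hamming-pending : ∀ f (c : Pending d n) x y σ τ →
    hamming (pending f c x σ) (pending f c y τ) ≤ mismatch x y + (hamming σ τ + hamming σ τ)
  hamming-pending f []           x y σ τ = z≤n
  hamming-pending f (same b c)   x y σ τ =
    ≤-trans (≤-reflexive (hamming-same b (pending f c x σ) (pending f c y τ))) (hamming-pending f c x y σ τ)
  hamming-pending f (second b c) x y σ τ = begin
    hamming (((f xor b) xor x) ∷ paired f c σ) (((f xor b) xor y) ∷ paired f c τ)
      ≡⟨ hamming-∷ ((f xor b) xor x) ((f xor b) xor y) (paired f c σ) (paired f c τ) ⟩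
    mismatch ((f xor b) xor x) ((f xor b) xor y) + hamming (paired f c σ) (paired f c τ)
      ≡⟨ cong (_+ hamming (paired f c σ) (paired f c τ)) (mismatch-xorˡ (f xor b) x y) ⟩
    mismatch x y + hamming (paired f c σ) (paired f c τ)
      ≤⟨ +-monoʳ-≤ (mismatch x y) (hamming-paired f c σ τ) ⟩
    mismatch x y + (hamming σ τ + hamming σ τ) ∎
    where open ≤-Reasoning

-- A record, so that a, u and b can be inferred from the type, which the bare equation of distances
-- would not allow.
record Between (a u b : Vertex d) : Set where
  constructor between
  field split : hamming a u + hamming u b ≡ hamming a b

between-same : ∀ x {a u b : Vertex d} → Between a u b → Between (x ∷ a) (x ∷ u) (x ∷ b)
between-same false (between btw) = between btw
between-same true  (between btw) = between btw

between-not : ∀ x y {a u b : Vertex d} → Between a u b → Between (x ∷ a) (y ∷ u) (not x ∷ b)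
between-not false false (between btw) = between (trans (+-suc _ _) (cong suc btw))
between-not false true  (between btw) = between (cong suc btw)
between-not true  false (between btw) = between (cong suc btw)
between-not true  true  (between btw) = between (trans (+-suc _ _) (cong suc btw))

xor-not : ∀ b x → b xor not x ≡ not (b xor x)
xor-not false x = refl
xor-not true  x = refl

mutual
  -- Coordinates outside the pairs have the same bit in all three vertices. On the others the two
  -- outer vertices differ, so either bit of the middle one adds 1 to exactly one of its distances.
  -- Therefore τ is independent of σ.
  between-paired : ∀ (c : Paired d n) σ τ → Between (paired false c σ) (paired true c τ) (paired false c (map not σ))
  between-paired []         σ       τ       = between refl
  between-paired (same b c) σ       τ       = between-same b (between-paired c σ τ)
  between-paired (first c)  (x ∷ σ) (y ∷ τ) = between-not x y (between-pending c x y σ τ)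

  between-pending : ∀ (c : Pending d n) x y σ τ →
    Between (pending false c x σ) (pending true c y τ) (pending false c (not x) (map not σ))
  between-pending []           x y σ τ = between refl
  between-pending (same b c)   x y σ τ = between-same b (between-pending c x y σ τ)
  between-pending (second b c) x y σ τ rewrite xor-not b x =
    between-not (b xor x) (not b xor y) (between-paired c σ τ)

Near : ℕ → ℕ → Set
Near i j = i ≡ j ⊎ i ≡ suc j ⊎ j ≡ suc i

near-suc : ∀ {i j} → Near i j → Near (suc i) (suc j)
near-suc (inj₁ i≡j)          = inj₁ (cong suc i≡j)
near-suc (inj₂ (inj₁ i≡1+j)) = inj₂ (inj₁ (cong suc i≡1+j))
near-suc (inj₂ (inj₂ j≡1+i)) = inj₂ (inj₂ (cong suc j≡1+i))

mutual
  -- Because f flips the second coordinate, the middle vertex agrees with each outer one in exactly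
  -- one coordinate of every complete pair. Only an incomplete last pair can unbalance the
  -- distances, by one.
  near-paired : ∀ (c : Paired d n) σ τ →
    Near (hamming (paired false c σ) (paired true c τ)) (hamming (paired true c τ) (paired false c (map not σ)))
  near-paired []             σ           τ           = inj₁ refl
  near-paired (same false c) σ           τ           = near-paired c σ τ
  near-paired (same true c)  σ           τ           = near-paired c σ τ
  near-paired (first c)      (false ∷ σ) (false ∷ τ) = near-pending c false false σ τ
  near-paired (first c)      (false ∷ σ) (true ∷ τ)  = near-pending c false true σ τ
  near-paired (first c)      (true ∷ σ)  (false ∷ τ) = near-pending c true false σ τ
  near-paired (first c)      (true ∷ σ)  (true ∷ τ)  = near-pending c true true σ τ

  -- The mismatches are the contributions of the open pair's first coordinate, kept until its second
  -- coordinate balances them.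
  near-pending : ∀ (c : Pending d n) x y σ τ →
    Near (mismatch x y + hamming (pending false c x σ) (pending true c y τ))
         (mismatch y (not x) + hamming (pending true c y τ) (pending false c (not x) (map not σ)))
  near-pending []               false false σ τ = inj₂ (inj₂ refl)
  near-pending []               false true  σ τ = inj₂ (inj₁ refl)
  near-pending []               true  false σ τ = inj₂ (inj₁ refl)
  near-pending []               true  true  σ τ = inj₂ (inj₂ refl)
  near-pending (same false c)   x     y     σ τ = near-pending c x y σ τ
  near-pending (same true c)    x     y     σ τ = near-pending c x y σ τ
  near-pending (second false c) false false σ τ = near-suc (near-paired c σ τ)
  near-pending (second false c) false true  σ τ = near-suc (near-paired c σ τ)
  near-pending (second false c) true  false σ τ = near-suc (near-paired c σ τ)
  near-pending (second false c) true  true  σ τ = near-suc (near-paired c σ τ)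
  near-pending (second true c)  false false σ τ = near-suc (near-paired c σ τ)
  near-pending (second true c)  false true  σ τ = near-suc (near-paired c σ τ)
  near-pending (second true c)  true  false σ τ = near-suc (near-paired c σ τ)
  near-pending (second true c)  true  true  σ τ = near-suc (near-paired c σ τ)

-- Rounding down serves i = j and j = i + 1, rounding up serves i = j + 1, so both parts of
-- `Midpoint` occur.
halfway : ∀ {i j k} → i + j ≡ k → Near i j → (i ≡ ⌊ k /2⌋ × i + j ≡ k) ⊎ (i ≡ ⌈ k /2⌉ × i + j ≡ k)
halfway {i}     refl (inj₁ refl)        = inj₁ (n≡⌊n+n/2⌋ i , refl)
halfway {_} {j} refl (inj₂ (inj₁ refl)) = inj₂ (cong suc (n≡⌊n+n/2⌋ j) , refl)
halfway {i}     refl (inj₂ (inj₂ refl)) =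
  inj₁ (trans (n≡⌈n+n/2⌉ i) (cong ⌊_/2⌋ (sym (+-suc i i))) , refl)

midpoint-paired : ∀ (c : Paired d n) σ τ → Midpoint (paired false c σ) (paired false c (map not σ)) (paired true c τ)
midpoint-paired c σ τ = halfway (Between.split (between-paired c σ τ)) (near-paired c σ τ)

∈-vertices : (v : Vertex n) → v ∈ vertices n
∈-vertices []          = here refl
∈-vertices (false ∷ v) = ∈-++⁺ˡ (∈-map⁺ (false ∷_) (∈-vertices v))
∈-vertices (true ∷ v)  = ∈-++⁺ʳ _ (∈-map⁺ (true ∷_) (∈-vertices v))

∈-elements : (A : VertexSet n) {v : Vertex n} → A v ≡ true → v ∈ elements A
∈-elements A Av = ∈-filter⁺ (T? ∘ A) (∈-vertices _) (Equivalence.from T-≡ Av)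

∈-m̂ : (S T : VertexSet d) {s t u : Vertex d} → S s ≡ true → T t ≡ true → Midpoint s t u → m̂ S T u ≡ true
∈-m̂ S T Ss Tt mid = Equivalence.to T-≡ (fromWitness (lose (∈-elements S Ss) (lose (∈-elements T Tt) mid)))

d⋆≤d : (S T : VertexSet d) → d⋆ S T ≤ d
d⋆≤d {d} S T = min≤⊤ d (cartesianProductWith hamming (elements S) (elements T))

d⋆-separated : (S T : VertexSet d) → Separated (d⋆ S T) S T
d⋆-separated {d} S T s t Ss Tt =
  All.lookup (min≤xs d (cartesianProductWith hamming (elements S) (elements T)))
    (∈-cartesianProductWith⁺ hamming (∈-elements S Ss) (∈-elements T Tt))

∧-trueˡ : ∀ {x y} → x ∧ y ≡ true → x ≡ true
∧-trueˡ {true} _ = refl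

∧-trueʳ : ∀ {x y} → x ∧ y ≡ true → y ≡ true
∧-trueʳ {true} y≡true = y≡true

p≤⌈p/2⌉+⌈p/2⌉ : ∀ p → p ≤ ⌈ p /2⌉ + ⌈ p /2⌉
p≤⌈p/2⌉+⌈p/2⌉ p = ≤-trans (≤-reflexive (sym (⌊n/2⌋+⌈n/2⌉≡n p))) (+-monoˡ-≤ ⌈ p /2⌉ (⌊n/2⌋≤⌈n/2⌉ p))

⌈p/2⌉≤ : ∀ {p h} → p ≤ h + h → ⌈ p /2⌉ ≤ h
⌈p/2⌉≤ {p} {h} p≤2h = ≤-trans (⌈n/2⌉-mono p≤2h) (≤-reflexive (sym (n≡⌈n+n/2⌉ h)))

-- The margin between 100 and 101 absorbs the extra 1 of an incomplete pair as soon as d is at least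
-- 100; this is the source of D = 100.
200*n≤101*d : d > 100 → n + n ≤ suc d → 200 * n ≤ 101 * d
200*n≤101*d {d} {n} d>100 2n≤1+d = begin
  200 * n          ≡⟨ double n ⟩
  100 * (n + n)    ≤⟨ *-monoʳ-≤ 100 2n≤1+d ⟩
  100 * suc d      ≡⟨ *-suc 100 d ⟩
  100 + 100 * d    ≤⟨ +-monoˡ-≤ (100 * d) (<⇒≤ d>100) ⟩
  101 * d          ∎
  where
  open ≤-Reasoning
  double : ∀ n → 200 * n ≡ 100 * (n + n)
  double = solve-∀

-- Densities in the classes and the curvature bound

complement-involutive : (σ : Vertex n) → map not (map not σ) ≡ σ
complement-involutive σ = trans (sym (map-∘ not not σ)) (trans (map-cong not-involutive σ) (map-id σ))

-- The set Q of the introductory outline.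
pairs : VertexSet d → VertexSet d → Paired d n → VertexSet n
pairs S T c σ = S (paired false c σ) ∧ T (paired false c (map not σ))

facing : VertexSet d → Paired d n → VertexSet n
facing M c σ = M (paired true c σ) ∧ M (paired true c (map not σ))

-- A single member of S × T in the class suffices: by `midpoint-paired`, every vertex of the
-- exchanged class is a midpoint of that one pair.
∣facing∣ : (S T : VertexSet d) (c : Paired d n) → Nonempty (pairs S T c) → ∣ facing (m̂ S T) c ∣ ≡ 2 ^ n
∣facing∣ {n = n} S T c (σ , σ∈) = begin
  ∣ facing (m̂ S T) c ∣       ≡⟨ ∣∣≡∑ (facing (m̂ S T) c) ⟩
  ∑ (𝟙 ∘ facing (m̂ S T) c)   ≡⟨ ∑-cong (λ τ → cong 𝟙 (cong₂ _∧_ (reached τ) (reached (map not τ)))) ⟩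
  ∑ {n} (λ _ → 1)            ≡⟨ ∑-1 {n} ⟩
  2 ^ n                      ∎
  where
  open ≡-Reasoning
  reached : ∀ τ → m̂ S T (paired true c τ) ≡ true
  reached τ = ∈-m̂ S T (∧-trueˡ σ∈) (∧-trueʳ {S (paired false c σ)} σ∈) (midpoint-paired c σ τ)

module _ (d p : ℕ) .{{_ : NonZero d}} (p≤d : p ≤ d) (d>100 : d > 100) where

  open Density d p p≤d

  -- A point σ of Q supplies a vertex of S and a point ρ of its antipodal set B a vertex of T,
  -- generally from different members of S × T. These are at distance at least p, so σ and ρ are at
  -- distance at least p / 2, and `separated-bound` applies to two sets of equal size.
  sparse : (c : Paired d n) (S T : VertexSet d) → Separated p S T → ∣ pairs S T c ∣ /1 ℚ.≤ (2 ^ n) /1 ℚ.* ω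
  sparse {n} c S T sep = subst (λ k → ∣ A ∣ /1 ℚ.≤ k ℚ.* ω) (sym (/1-homo-^ 2 n))
    (square-cancel-≤ (0≤* (0≤^ n (0≤/1 2)) 0≤ω) (begin
      ∣ A ∣ /1 ℚ.* ∣ A ∣ /1                               ≡⟨ cong (λ k → ∣ A ∣ /1 ℚ.* k /1) ∣B∣≡∣A∣ ⟨
      ∣ A ∣ /1 ℚ.* ∣ B ∣ /1                               ≤⟨ separated-bound ν κ ⌈ p /2⌉ A B 0<ν ν≤1 0<κ [1+ν]²≤κν separated ⟩
      κ ^ℚ n ℚ.* ν ^ℚ ⌈ p /2⌉                             ≤⟨ κ^n*ν^e≤ n (200*n≤101*d {n = n} d>100 (paired-size c)) ⌈ p /2⌉ (p≤⌈p/2⌉+⌈p/2⌉ p) ⟩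
      ((2 /1) ^ℚ n ℚ.* ω) ℚ.* ((2 /1) ^ℚ n ℚ.* ω)         ∎))
    where
    open ℚ.≤-Reasoning
    A B : VertexSet n
    A = pairs S T c
    -- This is `A ∘ map not` with the double complement already removed.
    B ρ = S (paired false c (map not ρ)) ∧ T (paired false c ρ)
    ∣B∣≡∣A∣ : ∣ B ∣ ≡ ∣ A ∣
    ∣B∣≡∣A∣ = trans (∣∣≡∑ B) (trans (sym (∑-complement (𝟙 ∘ B))) (trans
      (∑-cong (λ σ → cong (λ τ → 𝟙 (S (paired false c τ) ∧ T (paired false c (map not σ)))) (complement-involutive σ)))
      (sym (∣∣≡∑ A))))
    separated : Separated ⌈ p /2⌉ A B
    separated σ ρ σ∈A ρ∈B = ⌈p/2⌉≤ (≤-trans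
      (sep _ _ (∧-trueˡ σ∈A) (∧-trueʳ {S (paired false c (map not ρ))} ρ∈B))
      (hamming-paired false c σ ρ))

  ∣pairs∣≤∣facing∣ω : (S T : VertexSet d) → Separated p S T → (c : Paired d n) →
    ∣ pairs S T c ∣ /1 ℚ.≤ ∣ facing (m̂ S T) c ∣ /1 ℚ.* ω
  ∣pairs∣≤∣facing∣ω S T sep c = [ dense , empty ]′ (nonempty⊎∣∣≡0 (pairs S T c))
    where
    dense : Nonempty (pairs S T c) → ∣ pairs S T c ∣ /1 ℚ.≤ ∣ facing (m̂ S T) c ∣ /1 ℚ.* ω
    dense σ∈ = subst (λ k → ∣ pairs S T c ∣ /1 ℚ.≤ k /1 ℚ.* ω) (sym (∣facing∣ S T c σ∈)) (sparse c S T sep)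
    empty : ∣ pairs S T c ∣ ≡ 0 → ∣ pairs S T c ∣ /1 ℚ.≤ ∣ facing (m̂ S T) c ∣ /1 ℚ.* ω
    empty ∣A∣≡0 = ℚ.≤-trans (ℚ.≤-reflexive (cong _/1 ∣A∣≡0)) (0≤* (0≤/1 ∣ facing (m̂ S T) c ∣) 0≤ω)

  ∣S∣∣T∣≤∣m̂∣²ω : (S T : VertexSet d) → Separated p S T → (∣ S ∣ * ∣ T ∣) /1 ℚ.≤ (∣ m̂ S T ∣ * ∣ m̂ S T ∣) /1 ℚ.* ω
  ∣S∣∣T∣≤∣m̂∣²ω S T sep = subst₂ (λ k l → k /1 ℚ.≤ l /1 ℚ.* ω) (sym ∣S∣∣T∣≡) (sym ∣m̂∣²≡)
    (∑ᴾ-scaled d ω (λ c → ∑ (𝟙 ∘ pairs S T c)) (λ c → ∑ (𝟙 ∘ facing (m̂ S T) c))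
      (λ c → subst₂ (λ k l → k /1 ℚ.≤ l /1 ℚ.* ω) (∣∣≡∑ (pairs S T c)) (∣∣≡∑ (facing (m̂ S T) c)) (∣pairs∣≤∣facing∣ω S T sep c)))
    where
    ∣S∣∣T∣≡ : ∣ S ∣ * ∣ T ∣ ≡ ∑ᴾ d (λ c → ∑ (𝟙 ∘ pairs S T c))
    ∣S∣∣T∣≡ = trans (∣∣*∣∣≡∑² S T) (∑²-paired false d (λ a b → 𝟙 (S a ∧ T b)))
    ∣m̂∣²≡ : ∣ m̂ S T ∣ * ∣ m̂ S T ∣ ≡ ∑ᴾ d (λ c → ∑ (𝟙 ∘ facing (m̂ S T) c))
    ∣m̂∣²≡ = trans (∣∣*∣∣≡∑² (m̂ S T) (m̂ S T)) (∑²-paired true d (λ a b → 𝟙 (m̂ S T a ∧ m̂ S T b)))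

  midpoints-bound : (S T : VertexSet d) → Separated p S T → fromℕ ∣ m̂ S T ∣ ≥ᴿ √ (∣ S ∣ * ∣ T ∣) · exp (p /1 ℚ.* w)
  midpoints-bound S T sep (inj₁ q<0) = ℚ.<-≤-trans q<0 (0≤/1 ∣ m̂ S T ∣)
  midpoints-bound S T sep (inj₂ (a , b , 0≤a , 0≤b , inj₁ a<0 , _)) = contradiction refl (ℚ.<⇒≢ (ℚ.≤-<-trans 0≤a a<0))
  midpoints-bound S T sep {q} (inj₂ (a , b , 0≤a , 0≤b , inj₂ a²<N , (r , b<r , k , r≤) , q≤ab)) = ℚ.≤-<-trans q≤ab ab<m
    where
    m v : ℚ
    m = ∣ m̂ S T ∣ /1
    v = (1ℚ ℚ.- w) ^ℚ p
    0≤v : 0ℚ ℚ.≤ v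
    0≤v = 0≤^ p 0≤1-w
    bv≤1 : b ℚ.* v ℚ.≤ 1ℚ
    -- The lower limit exceeds b, so the partial sum at the threshold k is already at least b.
    bv≤1 = ℚ.≤-trans (*-monoʳ v 0≤v (ℚ.≤-trans (ℚ.<⇒≤ b<r) (r≤ k ≤-refl))) (expSum-bound w p k 0≤w w≤1)
    abv≤a : a ℚ.* b ℚ.* v ℚ.≤ a
    abv≤a = begin
      a ℚ.* b ℚ.* v      ≡⟨ ℚ.*-assoc a b v ⟩
      a ℚ.* (b ℚ.* v)    ≤⟨ *-monoˡ a 0≤a bv≤1 ⟩
      a ℚ.* 1ℚ           ≡⟨ ℚ.*-identityʳ a ⟩
      a                  ∎
      where open ℚ.≤-Reasoning
    ab<m : a ℚ.* b ℚ.< m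
    -- If m ≤ a b then m v ≤ a, and since ω = v² this gives |S| |T| ≤ (m v)² ≤ a², against a² < |S|
    -- |T|.
    ab<m = ℚ.≰⇒> (λ m≤ab → contradiction refl (ℚ.<⇒≢ (begin-strict
      a ℚ.* a                                   <⟨ a²<N ⟩
      (∣ S ∣ * ∣ T ∣) /1                        ≤⟨ ∣S∣∣T∣≤∣m̂∣²ω S T sep ⟩
      (∣ m̂ S T ∣ * ∣ m̂ S T ∣) /1 ℚ.* ω          ≡⟨ cong₂ ℚ._*_ (/1-homo-* ∣ m̂ S T ∣ ∣ m̂ S T ∣) (^-distrib-* (1ℚ ℚ.- w) (1ℚ ℚ.- w) p) ⟩
      m ℚ.* m ℚ.* (v ℚ.* v)                     ≡⟨ solve 2 (λ m v → m :* m :* (v :* v) := m :* v :* (m :* v)) refl m v ⟩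
      m ℚ.* v ℚ.* (m ℚ.* v)                     ≤⟨ *-mono 0≤mv 0≤mv (mv≤a m≤ab) (mv≤a m≤ab) ⟩
      a ℚ.* a                                   ∎)))
      where
      open ℚ.≤-Reasoning
      0≤mv : 0ℚ ℚ.≤ m ℚ.* v
      0≤mv = 0≤* (0≤/1 ∣ m̂ S T ∣) 0≤v
      mv≤a : m ℚ.≤ a ℚ.* b → m ℚ.* v ℚ.≤ a
      mv≤a m≤ab = ℚ.≤-trans (*-monoʳ v 0≤v m≤ab) abv≤a

proposition3p19 : ∃[ δ ] (0ℚ ℚ.< δ) × (∃[ D ] (∀ d → .{{_ : NonZero d}} → d > D →
    (curvature d ≥ᴿ fromℚ (½ ℚ.* (+ 1 ℚ./ d) ℚ.* (1ℚ ℚ.+ δ))) ×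
    ((S T : VertexSet d) → Nonempty S → Nonempty T →
    fromℕ ∣ m̂ S T ∣ ≥ᴿ
    √ (∣ S ∣ * ∣ T ∣) ·
    exp ((1ℚ ℚ.+ δ) ℚ.* (+ 1 ℚ./ 16) ℚ.* (+ 1 ℚ./ d) ℚ.* (d⋆ S T * d⋆ S T) /1))))
proposition3p19 = δ , ℚ.positive⁻¹ δ , 100 , λ d d>100 →
  -- K = (1 + δ)/(2 d) itself is the witness for every q below it. As K / 8 = (1 + δ)/(16 d) and (1
  -- + δ)/16 = 101/1600, both claims have the exponent p w.
  (λ q<K → ½ ℚ.* (+ 1 ℚ./ d) ℚ.* (1ℚ ℚ.+ δ) , q<K , λ S T _ _ →
    bound d d>100 S T (½ ℚ.* (+ 1 ℚ./ d) ℚ.* (1ℚ ℚ.+ δ) ℚ.* (+ 1 ℚ./ 8)) (λ p → solve 2 (λ ρ p →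
    con ½ :* ρ :* (con 1ℚ :+ con δ) :* con (+ 1 ℚ./ 8) :* (p :* p) := p :* (con (+ 101 ℚ./ 1600) :* (p :* ρ))) refl (+ 1 ℚ./ d) p)) ,
  (λ S T _ _ →
    bound d d>100 S T ((1ℚ ℚ.+ δ) ℚ.* (+ 1 ℚ./ 16) ℚ.* (+ 1 ℚ./ d)) (λ p → solve 2 (λ ρ p →
    (con 1ℚ :+ con δ) :* con (+ 1 ℚ./ 16) :* ρ :* (p :* p) := p :* (con (+ 101 ℚ./ 1600) :* (p :* ρ))) refl (+ 1 ℚ./ d) p))
  where
  δ : ℚ
  δ = + 1 ℚ./ 100
  bound : ∀ d .{{_ : NonZero d}} → d > 100 → (S T : VertexSet d) → ∀ x →
    (∀ p → x ℚ.* (p ℚ.* p) ≡ p ℚ.* ((+ 101 ℚ./ 1600) ℚ.* (p ℚ.* (+ 1 ℚ./ d)))) →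
    fromℕ ∣ m̂ S T ∣ ≥ᴿ √ (∣ S ∣ * ∣ T ∣) · exp (x ℚ.* (d⋆ S T * d⋆ S T) /1)
  bound d d>100 S T x eq = subst (λ y → fromℕ ∣ m̂ S T ∣ ≥ᴿ √ (∣ S ∣ * ∣ T ∣) · exp y)
    (sym (trans (cong (x ℚ.*_) (/1-homo-* (d⋆ S T) (d⋆ S T))) (eq (d⋆ S T /1))))
    (midpoints-bound d (d⋆ S T) (d⋆≤d S T) d>100 S T (d⋆-separated S T))
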